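{- Let $T\in\mathcal F$ be a trigraph with no balanced skew-partition. Then a set $X\subseteq V(T)$ is a weak fragment of $T$ if and only if $X$ is a proper fragment of $T$.
   Context: Trigraphs: finite $V(T)$ with $\theta:\binom{V(T)}{2}\to\{ -1,0,1\}$; $u,v$ strongly adjacent if $\theta(uv)=1$, strongly antiadjacent if $-1$, a switchable pair if $0$; adjacent (neighbours) if $\theta\in\{0,1\}$, antiadjacent (antineighbours) if $\theta\in\{ -1,0\}$. Complement $\overline T$: $-\theta$; $T|X$: induced trigraph. Strongly complete/anticomplete: strongly adjacent/antiadjacent to every vertex of a set. Full realization: graph on $V(T)$ of adjacent pairs. $X$ connected: full realization of $T|X$ connected; anticonnected: complement of graph on $X$ of strongly adjacent pairs connected; components = maximal connected subsets. Path: distinct $p_1,\dots,p_k$, consecutive adjacent, non-consecutive antiadjacent (length $k-1$, interior = inner vertices). Hole: $h_1,\dots,h_k$, $k\ge4$, $h_i,h_j$ adjacent iff $|i-j|\in\{1,k-1\}$, else antiadjacent. Antipath/antihole: complement is a path/hole in $\overline T$. Berge: no odd hole, no odd antihole. Skew-partition: partition $(A,B)$ of $V(T)$, $A$ not connected, $B$ not anticonnected; balanced if no path of odd length $>1$ with ends in $B$ and interior in $A$ and no antipath of odd length $>1$ with ends in $A$ and interior in $B$. $\mathcal F$: Berge trigraphs such that each component of the graph $\Sigma(T)$ of switchable pairs has at most two edges and each vertex $v$ of $\Sigma(T)$-degree two with $\Sigma(T)$-neighbours $x,y$ is either strongly complete to $V(T)\setminus\{v,x,y\}$ with $x,y$ strongly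 adjacent, or strongly anticomplete to $V(T)\setminus\{v,x,y\}$ with $x,y$ strongly antiadjacent. $2$-join: partition $(X_1,X_2)$ with disjoint $A_1,B_1,C_1,A_2,B_2,C_2$, $X_i=A_i\cup B_i\cup C_i$, $A_i,B_i\neq\emptyset$, no switchable pair between $X_1,X_2$, $A_1$ strongly complete to $A_2$, $B_1$ strongly complete to $B_2$, all other pairs between $X_1,X_2$ strongly antiadjacent, $|X_i|\ge3$, and if $|A_i|=|B_i|=1$ the full realization of $T|X_i$ is not a path of length two between the vertices of $A_i$ and $B_i$; proper if each component of $T|X_i$ meets $A_i$ and $B_i$. (Proper) complement $2$-join: (proper) $2$-join of $\overline T$. Proper homogeneous pair: disjoint nonempty $A,B\subseteq V(T)$ such that, letting $A_1$ ($A_2$) be the set of vertices of $V(T)\setminus(A\cup B)$ strongly complete (strongly anticomplete) to $A$ and $B_1,B_2$ likewise for $B$: $|A|>1$, $|B|>1$; $A_1\cup A_2=B_1\cup B_2=V(T)\setminus(A\cup B)$; every vertex of $A$ has a neighbour and an antineighbour in $B$ and vice versa; and $A_1\cap B_1,A_1\cap B_2,A_2\cap B_1,A_2\cap B_2$ are nonempty. Proper fragment: $X\subseteq V(T)$ such that $(X,V(T)\setminus X)$ is a proper $2$-join or proper complement $2$-join of $T$, or $X=A\cup B$ for a proper homogeneous pair $(A,B)$. Weak fragment: $X\subseteq V(T)$ for which there are disjoint sets $A_1,B_1,C_1,D_1,A_2,B_2,C_2,D_2$ with $X=A_1\cup B_1\cup C_1\cup D_1$, $V(T)\setminus X=A_2\cup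 B_2\cup C_2\cup D_2$, $A_1$ strongly complete to $A_2\cup D_2$ and strongly anticomplete to $B_2\cup C_2$, $B_1$ strongly complete to $B_2\cup D_2$ and strongly anticomplete to $A_2\cup C_2$, $C_1$ strongly anticomplete to $A_2\cup B_2\cup C_2$, $D_1$ strongly complete to $A_2\cup B_2\cup D_2$, $|X|\ge4$, $|V(T)\setminus X|\ge4$, $|A_i|,|B_i|\ge1$ for $i=1,2$, and at least one of: ($C_1=D_1=\emptyset$, $C_2\neq\emptyset$, $D_2\neq\emptyset$), or $D_1=D_2=\emptyset$, or $C_1=C_2=\emptyset$. -}

module Defs where

open import Data.Nat using (ℕ; zero; suc; _+_; _*_; _∸_; _<_; _≤_; ∣_-_∣)
import Data.Nat.Properties as ℕP
open import Data.Fin using (Fin; toℕ; fromℕ) renaming (zero to fzero)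
import Data.Fin.Properties as FinP
open import Data.Fin.Subset using (Subset; _∈_; _∉_; _⊆_; ∁; ∣_∣)
open import Data.Fin.Subset.Properties using (_∈?_)
open import Data.List using (List; length; filter; cartesianProduct; allFin)
open import Data.Product using (Σ; ∃; _×_; _,_; proj₁; proj₂)
open import Data.Sum using (_⊎_)
open import Data.Empty using (⊥)
open import Relation.Nullary using (¬_; Dec; yes; no)
open import Relation.Nullary.Decidable using (_×-dec_)
open import Relation.Binary.PropositionalEquality using (_≡_; _≢_; refl; cong)

-- neg = -1 (strongly antiadjacent), zer = 0 (switchable), pos = 1 (strongly adjacent)
data Tri : Set where
  neg zer pos : Tri

_≟T_ : (x y : Tri) → Dec (x ≡ y)
neg ≟T neg = yes refl
neg ≟T zer = no (λ ())
neg ≟T pos = no (λ ())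
zer ≟T neg = no (λ ())
zer ≟T zer = yes refl
zer ≟T pos = no (λ ())
pos ≟T neg = no (λ ())
pos ≟T zer = no (λ ())
pos ≟T pos = yes refl

-- θ is a function on unordered pairs: we take a symmetric function on
-- ordered pairs; its values on the diagonal are irrelevant and never used.
record Trigraph (n : ℕ) : Set where
  field
    θ   : Fin n → Fin n → Tri
    θ-sym : ∀ u v → θ u v ≡ θ v u
open Trigraph public

negT : Tri → Tri
negT neg = pos
negT zer = zer
negT pos = neg

compl : ∀ {n} → Trigraph n → Trigraph n
compl T = record { θ = λ u v → negT (θ T u v) ; θ-sym = λ u v → cong negT (θ-sym T u v) }

module _ {n : ℕ} (T : Trigraph n) where

  StrAdj StrAnti Switch Adj Antiadj : Fin n → Fin n → Set
  StrAdj  u v = θ T u v ≡ pos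
  StrAnti u v = θ T u v ≡ neg
  Switch  u v = θ T u v ≡ zer
  Adj     u v = θ T u v ≡ zer ⊎ θ T u v ≡ pos
  Antiadj u v = θ T u v ≡ neg ⊎ θ T u v ≡ zer

  SComplete SAnticomplete : Fin n → Subset n → Set
  SComplete     v S = ∀ s → s ∈ S → StrAdj v s
  SAnticomplete v S = ∀ s → s ∈ S → StrAnti v s

data Reach {n : ℕ} (R : Fin n → Fin n → Set) (X : Subset n) (u : Fin n) : Fin n → Set where
  start : Reach R X u u
  step  : ∀ {v w} → Reach R X u v → w ∈ X → v ≢ w → R v w → Reach R X u w

ConnectedBy : ∀ {n} → (Fin n → Fin n → Set) → Subset n → Set
ConnectedBy R X = ∀ u v → u ∈ X → v ∈ X → Reach R X u v

-- X connected: full realization of T|X (edges = adjacent pairs) is connected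
Connected : ∀ {n} → Trigraph n → Subset n → Set
Connected T X = ConnectedBy (Adj T) X

-- X anticonnected: complement of the graph on X of strongly adjacent pairs
-- (i.e. the graph on X whose edges are the antiadjacent pairs) is connected
Anticonnected : ∀ {n} → Trigraph n → Subset n → Set
Anticonnected T X = ConnectedBy (Antiadj T) X

IsComponentBy : ∀ {n} → (Fin n → Fin n → Set) → Subset n → Subset n → Set
IsComponentBy {n} R Y C =
  C ⊆ Y × (∃ λ v → v ∈ C) × ConnectedBy R C ×
  (∀ (D : Subset n) → C ⊆ D → D ⊆ Y → ConnectedBy R D → D ⊆ C)

Odd : ℕ → Set
Odd k = ∃ λ m → k ≡ suc (2 * m)

record IsPath {n : ℕ} (T : Trigraph n) (ℓ : ℕ) (p : Fin (suc ℓ) → Fin n) : Set where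
  field
    distinct : ∀ i j → p i ≡ p j → i ≡ j
    consec   : ∀ i j → suc (toℕ i) ≡ toℕ j → Adj T (p i) (p j)
    nonconsec : ∀ i j → suc (toℕ i) < toℕ j → Antiadj T (p i) (p j)

IsAntipath : ∀ {n} → Trigraph n → (ℓ : ℕ) → (Fin (suc ℓ) → Fin n) → Set
IsAntipath T = IsPath (compl T)

-- a hole h_1 ... h_k (indexed from 0 here), k ≥ 4
record IsHole {n : ℕ} (T : Trigraph n) (k : ℕ) (h : Fin k → Fin n) : Set where
  field
    big      : 4 ≤ k
    distinct : ∀ i j → h i ≡ h j → i ≡ j
    adj      : ∀ i j → i ≢ j →
                 (∣ toℕ i - toℕ j ∣ ≡ 1 ⊎ ∣ toℕ i - toℕ j ∣ ≡ k ∸ 1) → Adj T (h i) (h j)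
    antiadj  : ∀ i j → i ≢ j →
                 ¬ (∣ toℕ i - toℕ j ∣ ≡ 1 ⊎ ∣ toℕ i - toℕ j ∣ ≡ k ∸ 1) → Antiadj T (h i) (h j)

IsAntihole : ∀ {n} → Trigraph n → (k : ℕ) → (Fin k → Fin n) → Set
IsAntihole T = IsHole (compl T)

Berge : ∀ {n} → Trigraph n → Set
Berge {n} T =
  (∀ k (h : Fin k → Fin n) → IsHole T k h → Odd k → ⊥) ×
  (∀ k (h : Fin k → Fin n) → IsAntihole T k h → Odd k → ⊥)

SkewPartition : ∀ {n} → Trigraph n → Subset n → Set
SkewPartition T A = ¬ Connected T A × ¬ Anticonnected T (∁ A)

BalancedSkew : ∀ {n} → Trigraph n → Subset n → Set
BalancedSkew {n} T A =
  (∀ ℓ (p : Fin (suc ℓ) → Fin n) → IsPath T ℓ p → Odd ℓ → 1 < ℓ →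
     p fzero ∈ ∁ A → p (fromℕ ℓ) ∈ ∁ A →
     (∀ i → 0 < toℕ i → toℕ i < ℓ → p i ∈ A) → ⊥) ×
  (∀ ℓ (p : Fin (suc ℓ) → Fin n) → IsAntipath T ℓ p → Odd ℓ → 1 < ℓ →
     p fzero ∈ A → p (fromℕ ℓ) ∈ A →
     (∀ i → 0 < toℕ i → toℕ i < ℓ → p i ∈ ∁ A) → ⊥)

HasBalancedSkewPartition : ∀ {n} → Trigraph n → Set
HasBalancedSkewPartition {n} T = ∃ λ (A : Subset n) → SkewPartition T A × BalancedSkew T A

switchEdgesIn : ∀ {n} → Trigraph n → Subset n → ℕ
switchEdgesIn {n} T C =
  length (filter (λ (uv : Fin n × Fin n) →
                     (toℕ (proj₁ uv) ℕP.<? toℕ (proj₂ uv)) ×-dec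
                     ((proj₁ uv ∈? C) ×-dec ((proj₂ uv ∈? C) ×-dec
                      (θ T (proj₁ uv) (proj₂ uv) ≟T zer))))
                 (cartesianProduct (allFin n) (allFin n)))

V : ∀ {n} → Subset n
V = ∁ Data.Fin.Subset.⊥
  where import Data.Fin.Subset

InF : ∀ {n} → Trigraph n → Set
InF {n} T =
  Berge T ×
  (∀ (C : Subset n) → IsComponentBy (Switch T) V C → switchEdgesIn T C ≤ 2) ×
  (∀ v x y → x ≢ y → x ≢ v → y ≢ v → Switch T v x → Switch T v y →
     (∀ z → z ≢ v → Switch T v z → z ≡ x ⊎ z ≡ y) →
     ((∀ z → z ≢ v → z ≢ x → z ≢ y → StrAdj T v z) × StrAdj T x y) ⊎
     ((∀ z → z ≢ v → z ≢ x → z ≢ y → StrAnti T v z) × StrAnti T x y))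

-- 2-joins.  The sets A₁,B₁,C₁,A₂,B₂,C₂ are given by a labelling
-- L : V(T) → Side × Role3 (so they are disjoint and cover V(T));
-- X_i is the set of vertices labelled with side i.

data Side : Set where
  s1 s2 : Side

data Role3 : Set where
  rA rB rC : Role3

record Is2Join {n : ℕ} (T : Trigraph n) (X : Subset n) (L : Fin n → Side × Role3) : Set where
  field
    sideX   : ∀ v → (v ∈ X → proj₁ (L v) ≡ s1) × (proj₁ (L v) ≡ s1 → v ∈ X)
    nonemptyA : ∀ s → ∃ λ v → L v ≡ (s , rA)
    nonemptyB : ∀ s → ∃ λ v → L v ≡ (s , rB)
    compAA  : ∀ u v → L u ≡ (s1 , rA) → L v ≡ (s2 , rA) → StrAdj T u v
    compBB  : ∀ u v → L u ≡ (s1 , rB) → L v ≡ (s2 , rB) → StrAdj T u v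
    -- all other pairs between X₁ and X₂ strongly antiadjacent
    -- (in particular no switchable pair between X₁ and X₂)
    anti    : ∀ u v r r′ → L u ≡ (s1 , r) → L v ≡ (s2 , r′) →
                ¬ (r ≡ rA × r′ ≡ rA) → ¬ (r ≡ rB × r′ ≡ rB) → StrAnti T u v
    size1   : 3 ≤ ∣ X ∣
    size2   : 3 ≤ ∣ ∁ X ∣
    -- if |A_i| = |B_i| = 1 then the full realization of T|X_i is not a path
    -- of length two between the vertex of A_i and the vertex of B_i
    notP2   : ∀ s a b m →
                (∀ v → L v ≡ (s , rA) → v ≡ a) → L a ≡ (s , rA) →
                (∀ v → L v ≡ (s , rB) → v ≡ b) → L b ≡ (s , rB) →
                proj₁ (L m) ≡ s → m ≢ a → m ≢ b →
                (∀ v → proj₁ (L v) ≡ s → v ≡ a ⊎ v ≡ b ⊎ v ≡ m) →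
                Adj T a m → Adj T m b → StrAnti T a b → ⊥

IsProper2Join : ∀ {n} → Trigraph n → Subset n → Set
IsProper2Join {n} T X = ∃ λ (L : Fin n → Side × Role3) → Is2Join T X L ×
  (∀ s (Y C : Subset n) → (∀ v → (v ∈ Y → proj₁ (L v) ≡ s) × (proj₁ (L v) ≡ s → v ∈ Y)) →
     IsComponentBy (Adj T) Y C →
     (∃ λ v → v ∈ C × L v ≡ (s , rA)) × (∃ λ v → v ∈ C × L v ≡ (s , rB)))

IsProperComplement2Join : ∀ {n} → Trigraph n → Subset n → Set
IsProperComplement2Join T X = IsProper2Join (compl T) X

record ProperHomogeneousPair {n : ℕ} (T : Trigraph n) (A B : Subset n) : Set where
  field
    disjoint : ∀ v → v ∈ A → v ∈ B → ⊥
    nonemptyA : ∃ λ v → v ∈ A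
    nonemptyB : ∃ λ v → v ∈ B
    bigA : 1 < ∣ A ∣
    bigB : 1 < ∣ B ∣
    -- A₁ ∪ A₂ = B₁ ∪ B₂ = V(T) \ (A ∪ B)
    coverA : ∀ v → v ∉ A → v ∉ B → SComplete T v A ⊎ SAnticomplete T v A
    coverB : ∀ v → v ∉ A → v ∉ B → SComplete T v B ⊎ SAnticomplete T v B
    nbAB : ∀ a → a ∈ A → (∃ λ b → b ∈ B × Adj T a b) × (∃ λ b → b ∈ B × Antiadj T a b)
    nbBA : ∀ b → b ∈ B → (∃ λ a → a ∈ A × Adj T b a) × (∃ λ a → a ∈ A × Antiadj T b a)
    a1b1 : ∃ λ v → v ∉ A × v ∉ B × SComplete T v A × SComplete T v B
    a1b2 : ∃ λ v → v ∉ A × v ∉ B × SComplete T v A × SAnticomplete T v B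
    a2b1 : ∃ λ v → v ∉ A × v ∉ B × SAnticomplete T v A × SComplete T v B
    a2b2 : ∃ λ v → v ∉ A × v ∉ B × SAnticomplete T v A × SAnticomplete T v B

ProperFragment : ∀ {n} → Trigraph n → Subset n → Set
ProperFragment {n} T X =
  IsProper2Join T X ⊎ IsProperComplement2Join T X ⊎
  (∃ λ (A : Subset n) → ∃ λ (B : Subset n) → ProperHomogeneousPair T A B ×
     (∀ v → (v ∈ X → v ∈ A ⊎ v ∈ B) × (v ∈ A ⊎ v ∈ B → v ∈ X)))

-- Weak fragments.  A₁,B₁,C₁,D₁,A₂,B₂,C₂,D₂ given by a labelling
-- L : V(T) → Side × Role4; X = side s1.

data Role4 : Set where
  wA wB wC wD : Role4

Empty4 : ∀ {n} → (Fin n → Side × Role4) → Side → Role4 → Set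
Empty4 L s r = ∀ v → L v ≢ (s , r)

NonEmpty4 : ∀ {n} → (Fin n → Side × Role4) → Side → Role4 → Set
NonEmpty4 L s r = ∃ λ v → L v ≡ (s , r)

record IsWeakFragmentBy {n : ℕ} (T : Trigraph n) (X : Subset n) (L : Fin n → Side × Role4) : Set where
  field
    sideX : ∀ v → (v ∈ X → proj₁ (L v) ≡ s1) × (proj₁ (L v) ≡ s1 → v ∈ X)
    A-comp : ∀ u v → L u ≡ (s1 , wA) → L v ≡ (s2 , wA) ⊎ L v ≡ (s2 , wD) → StrAdj T u v
    A-anti : ∀ u v → L u ≡ (s1 , wA) → L v ≡ (s2 , wB) ⊎ L v ≡ (s2 , wC) → StrAnti T u v
    B-comp : ∀ u v → L u ≡ (s1 , wB) → L v ≡ (s2 , wB) ⊎ L v ≡ (s2 , wD) → StrAdj T u v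
    B-anti : ∀ u v → L u ≡ (s1 , wB) → L v ≡ (s2 , wA) ⊎ L v ≡ (s2 , wC) → StrAnti T u v
    C-anti : ∀ u v → L u ≡ (s1 , wC) →
               L v ≡ (s2 , wA) ⊎ L v ≡ (s2 , wB) ⊎ L v ≡ (s2 , wC) → StrAnti T u v
    D-comp : ∀ u v → L u ≡ (s1 , wD) →
               L v ≡ (s2 , wA) ⊎ L v ≡ (s2 , wB) ⊎ L v ≡ (s2 , wD) → StrAdj T u v
    size1 : 4 ≤ ∣ X ∣
    size2 : 4 ≤ ∣ ∁ X ∣
    nonemptyA : ∀ s → NonEmpty4 L s wA
    nonemptyB : ∀ s → NonEmpty4 L s wB
    cases : (Empty4 L s1 wC × Empty4 L s1 wD × NonEmpty4 L s2 wC × NonEmpty4 L s2 wD)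
            ⊎ (Empty4 L s1 wD × Empty4 L s2 wD)
            ⊎ (Empty4 L s1 wC × Empty4 L s2 wC)

WeakFragment : ∀ {n} → Trigraph n → Subset n → Set
WeakFragment {n} T X = ∃ λ (L : Fin n → Side × Role4) → IsWeakFragmentBy T X L

{-# OPTIONS --safe #-}
module Submission where

-- Everything rests on one tool: a star cutset yields a balanced skew-partition, since after absorbing
-- the strong neighbours of the centre into the star, the centre closes any path or antipath violating
-- balance to an odd hole or antihole.
--
-- A weak fragment is a homogeneous pair, a 2-join or a complement 2-join without the properness
-- conditions, and each failure of properness is a star cutset, with two exceptions in the case of pairs.
-- A vertex a of A without neighbours in B, |A| > 1, yields another balanced skew-partition; and if
-- A = {a}, then a is switchable with all of B, against the bound on switchable components.
--
-- Conversely, the only question is whether both sides of a proper 2-join have at least four vertices.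
-- A side {a, b, m} is again a star cutset unless it violates the degree condition on switchable pairs
-- or is a triangle with a b switchable; then a shortest path through the other side closes to two holes
-- whose lengths differ by one.

open import Defs
open import Data.Nat using (ℕ; zero; suc; _+_; _∸_; _<_; _≤_; z≤n; s≤s; z<s) renaming (∣_-_∣ to dist)
import Data.Nat.Properties as ℕₚ
open import Data.Nat.Induction using (<-rec)
open import Data.Fin using (Fin; toℕ; fromℕ) renaming (zero to fzero; suc to fsuc)
open import Data.Fin.Properties using (any?; toℕ-injective; toℕ<n; suc-injective; _≟_)
open import Data.Fin.Subset using (Subset; _∈_; _∉_; _⊆_; ∁; ∣_∣; _∪_; ⁅_⁆; _-_; inside; outside)
open import Data.Fin.Subset.Properties using (_∈?_; nonempty?; Empty-unique; ∣⊥∣≡0; drop-there; p⊆q⇒∣p∣≤∣q∣; ∣p∣≤∣x∷p∣; x∈p∧x≢y⇒x∈p-y; x∈p⇒∣p-x∣<∣p∣; x∈⁅x⁆; x∈⁅y⁆⇒x≡y; x∈p∪q⁻; p⊆p∪q; q⊆p∪q; x∈∁p⇒x∉p; x∉p⇒x∈∁p; ∉⊥)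
open import Data.Fin.Subset.Induction using (⊃-wellFounded; Acc; acc)
open import Data.Vec using (tabulate; here; there) renaming ([] to []ᵥ; _∷_ to _∷ᵥ_)
open import Data.Vec.Properties using (lookup∘tabulate; []=⇒lookup; lookup⇒[]=)
open import Data.List using (List; []; _∷_; length; lookup; filter; cartesianProduct; allFin)
open import Data.List.Relation.Unary.All using (All; []; _∷_)
import Data.List.Relation.Unary.All as All
open import Data.List.Relation.Unary.AllPairs using (AllPairs; []; _∷_)
open import Data.List.Relation.Unary.Any using (index)
open import Data.List.Relation.Unary.Any.Properties using (lookup-index)
import Data.List.Membership.Propositional as List
open import Data.List.Membership.Propositional.Properties using (∈-filter⁺; ∈-cartesianProduct⁺; ∈-allFin)
open import Data.Product using (∃; _×_; _,_; proj₁; proj₂; map₂)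
open import Data.Product.Properties using (≡-dec)
open import Data.Sum using (_⊎_; inj₁; inj₂; [_,_]′)
open import Data.Empty using (⊥; ⊥-elim)
open import Function using (_∘_; case_of_)
open import Relation.Nullary using (¬_; Dec; yes; no)
open import Relation.Nullary.Decidable using (does; dec-true; _×-dec_; _⊎-dec_; ¬?)
open import Relation.Binary using (tri<; tri≈; tri>)
open import Relation.Binary.PropositionalEquality using (_≡_; _≢_; refl; sym; trans; cong; cong₂; subst)

-- Switchable pairs are the obstacle. The leaves of a star have to be strong neighbours of its
-- centre, since otherwise the star could be anticonnected; a switchable neighbour of the centre
-- stays outside. So in a side {a, b, m} the vertex b can join the star of a when ab is strong, but
-- not when ab is switchable, and that case needs an argument of its own.
--
-- The bound four is what the arguments consume. For a pair with A = {a} it leaves three vertices in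
-- B, hence three switchable pairs at a, one more than a component of switchable pairs may have. For
-- a 2-join it leaves no room for the exceptional path of length two.
--
-- Class, skew-partitions and weak fragments are all self-complementary. Antineighbours in a
-- homogeneous pair and complement 2-joins are therefore obtained by applying the statements about
-- neighbours and 2-joins to `compl T`.

private variable
  n ℓ : ℕ

-- Finite subsets

select : {P : Fin n → Set} → (∀ v → Dec (P v)) → Subset n
select P? = tabulate (does ∘ P?)

∈-select⁺ : {P : Fin n → Set} (P? : ∀ v → Dec (P v)) {v : Fin n} → P v → v ∈ select P?
∈-select⁺ P? {v} p = lookup⇒[]= v _ (trans (lookup∘tabulate (does ∘ P?) v) (dec-true (P? v) p))

∈-select⁻ : {P : Fin n → Set} (P? : ∀ v → Dec (P v)) {v : Fin n} → v ∈ select P? → P v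
∈-select⁻ P? {v} v∈ with P? v | trans (sym (lookup∘tabulate (does ∘ P?) v)) ([]=⇒lookup v∈)
... | yes p | _  = p
... | no _  | ()

∁-select⁻ : {P : Fin n → Set} (P? : ∀ v → Dec (P v)) {v : Fin n} → v ∈ ∁ (select P?) → ¬ P v
∁-select⁻ P? v∈ p = x∈∁p⇒x∉p v∈ (∈-select⁺ P? p)

∁-select⁺ : {P : Fin n → Set} (P? : ∀ v → Dec (P v)) {v : Fin n} → ¬ P v → v ∈ ∁ (select P?)
∁-select⁺ P? ¬p = x∉p⇒x∈∁p (¬p ∘ ∈-select⁻ P?)

p⊆q∪x⇒∣p∣≤1+∣q∣ : (p q : Subset n) (x : Fin n) → (∀ {y} → y ∈ p → y ≢ x → y ∈ q) → ∣ p ∣ ≤ suc ∣ q ∣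
p⊆q∪x⇒∣p∣≤1+∣q∣ (s ∷ᵥ p) (t ∷ᵥ q) fzero h = ℕₚ.≤-trans (head≤ s)
  (s≤s (ℕₚ.≤-trans (p⊆q⇒∣p∣≤∣q∣ (λ y∈ → drop-there (h (there y∈) (λ ())))) (∣p∣≤∣x∷p∣ t q)))
  where
  head≤ : ∀ s → ∣ s ∷ᵥ p ∣ ≤ suc ∣ p ∣
  head≤ inside  = ℕₚ.≤-refl
  head≤ outside = ℕₚ.n≤1+n _
p⊆q∪x⇒∣p∣≤1+∣q∣ (outside ∷ᵥ p) (t ∷ᵥ q) (fsuc x) h =
  ℕₚ.≤-trans (p⊆q∪x⇒∣p∣≤1+∣q∣ p q x (λ y∈ y≢ → drop-there (h (there y∈) (y≢ ∘ suc-injective)))) (s≤s (∣p∣≤∣x∷p∣ t q))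
p⊆q∪x⇒∣p∣≤1+∣q∣ (inside ∷ᵥ p) (inside ∷ᵥ q) (fsuc x) h =
  s≤s (p⊆q∪x⇒∣p∣≤1+∣q∣ p q x (λ y∈ y≢ → drop-there (h (there y∈) (y≢ ∘ suc-injective))))
p⊆q∪x⇒∣p∣≤1+∣q∣ (inside ∷ᵥ p) (outside ∷ᵥ q) (fsuc x) h = case h here (λ ()) of λ ()

-- Striking out a listed vertex costs at most one element, so something of `S` is left. The bounds
-- three and four on the sides become vertices in this way.
fresh : (S : Subset n) (xs : List (Fin n)) → length xs < ∣ S ∣ → ∃ λ w → w ∈ S × All (w ≢_) xs
fresh {n} S [] 0<∣S∣ with nonempty? S
... | yes (w , w∈) = w , w∈ , []
... | no empty = ⊥-elim (ℕₚ.<-irrefl refl (subst (0 <_) (trans (cong ∣_∣ (Empty-unique empty)) (∣⊥∣≡0 n)) 0<∣S∣))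
fresh S (x ∷ xs) lt
  with fresh (select keep?) xs (ℕₚ.≤-pred (ℕₚ.≤-trans lt (p⊆q∪x⇒∣p∣≤1+∣q∣ S _ x (λ y∈ y≢ → ∈-select⁺ keep? (y∈ , y≢)))))
  where
  keep? : ∀ v → Dec (v ∈ S × v ≢ x)
  keep? v = (v ∈? S) ×-dec ¬? (v ≟ x)
... | w , w∈ , w≢ with ∈-select⁻ (λ v → (v ∈? S) ×-dec ¬? (v ≟ x)) w∈
... | w∈S , w≢x = w , w∈S , w≢x ∷ w≢

distinct⇒≤∣S∣ : (S : Subset n) (xs : List (Fin n)) → AllPairs _≢_ xs → All (_∈ S) xs → length xs ≤ ∣ S ∣
distinct⇒≤∣S∣ S []       _          _         = z≤n
distinct⇒≤∣S∣ S (x ∷ xs) (x≢ ∷ ≢s) (x∈ ∷ ∈s) =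
  ℕₚ.≤-<-trans (distinct⇒≤∣S∣ (S - x) xs ≢s
    (All.zipWith (λ (w∈ , x≢w) → x∈p∧x≢y⇒x∈p-y w∈ (x≢w ∘ sym)) (∈s , x≢)))
    (x∈p⇒∣p-x∣<∣p∣ x∈)

-- Signs and complementation

¬adj⇒neg : ∀ {t} → ¬ (t ≡ zer ⊎ t ≡ pos) → t ≡ neg
¬adj⇒neg {neg} _ = refl
¬adj⇒neg {zer} h = ⊥-elim (h (inj₁ refl))
¬adj⇒neg {pos} h = ⊥-elim (h (inj₂ refl))

≢pos⇒anti : ∀ {t} → t ≢ pos → t ≡ neg ⊎ t ≡ zer
≢pos⇒anti {neg} _ = inj₁ refl
≢pos⇒anti {zer} _ = inj₂ refl
≢pos⇒anti {pos} h = ⊥-elim (h refl)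

≢neg⇒adj : ∀ {t} → t ≢ neg → t ≡ zer ⊎ t ≡ pos
≢neg⇒adj {neg} h = ⊥-elim (h refl)
≢neg⇒adj {zer} _ = inj₁ refl
≢neg⇒adj {pos} _ = inj₂ refl

pos-anti : ∀ {t} → t ≡ pos → ¬ (t ≡ neg ⊎ t ≡ zer)
pos-anti refl (inj₁ ())
pos-anti refl (inj₂ ())

neg-adj : ∀ {t} → t ≡ neg → ¬ (t ≡ zer ⊎ t ≡ pos)
neg-adj refl (inj₁ ())
neg-adj refl (inj₂ ())

anti⇒adjᶜ : ∀ {t} → t ≡ neg ⊎ t ≡ zer → negT t ≡ zer ⊎ negT t ≡ pos
anti⇒adjᶜ (inj₁ refl) = inj₂ refl
anti⇒adjᶜ (inj₂ refl) = inj₁ refl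

adj⇒antiᶜ : ∀ {t} → t ≡ zer ⊎ t ≡ pos → negT t ≡ neg ⊎ negT t ≡ zer
adj⇒antiᶜ (inj₁ refl) = inj₂ refl
adj⇒antiᶜ (inj₂ refl) = inj₁ refl

negT-involutive : ∀ t → negT (negT t) ≡ t
negT-involutive neg = refl
negT-involutive zer = refl
negT-involutive pos = refl

negT-injective : ∀ {s t} → negT s ≡ negT t → s ≡ t
negT-injective {s} {t} e = trans (sym (negT-involutive s)) (trans (cong negT e) (negT-involutive t))

adjᶜ⇒anti : ∀ {t} → negT t ≡ zer ⊎ negT t ≡ pos → t ≡ neg ⊎ t ≡ zer
adjᶜ⇒anti (inj₁ e) = inj₂ (negT-injective e)
adjᶜ⇒anti (inj₂ e) = inj₁ (negT-injective e)

antiᶜ⇒adj : ∀ {t} → negT t ≡ neg ⊎ negT t ≡ zer → t ≡ zer ⊎ t ≡ pos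
antiᶜ⇒adj (inj₁ e) = inj₂ (negT-injective e)
antiᶜ⇒adj (inj₂ e) = inj₁ (negT-injective e)

adj? : (T : Trigraph n) → ∀ u v → Dec (Adj T u v)
adj? T u v = (θ T u v ≟T zer) ⊎-dec (θ T u v ≟T pos)

adj-sym : (T : Trigraph n) → ∀ {u v} → Adj T u v → Adj T v u
adj-sym T {u} {v} = subst (λ t → t ≡ zer ⊎ t ≡ pos) (θ-sym T u v)

antiadj-sym : (T : Trigraph n) → ∀ {u v} → Antiadj T u v → Antiadj T v u
antiadj-sym T {u} {v} = subst (λ t → t ≡ neg ⊎ t ≡ zer) (θ-sym T u v)

θ-flip : (T : Trigraph n) → ∀ {u v t} → θ T u v ≡ t → θ T v u ≡ t
θ-flip T {u} {v} = trans (θ-sym T v u)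

-- Connectivity

reach-mono : {R : Fin n → Fin n → Set} {X Y : Subset n} → X ⊆ Y → ∀ {u v} → Reach R X u v → Reach R Y u v
reach-mono X⊆Y start            = start
reach-mono X⊆Y (step p w∈ v≢w r) = step (reach-mono X⊆Y p) (X⊆Y w∈) v≢w r

reach-trans : {R : Fin n → Fin n → Set} {X : Subset n} → ∀ {u v w} → Reach R X u v → Reach R X v w → Reach R X u w
reach-trans p start            = p
reach-trans p (step q w∈ v≢w r) = step (reach-trans p q) w∈ v≢w r

-- Membership in `X` is carried along with `P`: a step of `Reach` records it only for its endpoint,
-- whereas closure is assumed only for steps with both ends in `X`.
reach-preserves : {R : Fin n → Fin n → Set} {X : Subset n} (P : Fin n → Set) →
  (∀ u v → u ∈ X → v ∈ X → P u → R u v → P v) → ∀ {u v} → u ∈ X → P u → Reach R X u v → P v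
reach-preserves {R = R} {X} P closed u∈ pu = proj₂ ∘ go
  where
  go : ∀ {v} → Reach R X _ v → v ∈ X × P v
  go start            = u∈ , pu
  go (step p w∈ _ r) = w∈ , closed _ _ (proj₁ (go p)) w∈ (proj₂ (go p)) r

module Components (R : Fin n → Fin n → Set) (R-sym : ∀ {u v} → R u v → R v u) where

  reach-sym : {X : Subset n} → ∀ {u v} → u ∈ X → Reach R X u v → Reach R X v u
  reach-sym u∈ start = start
  reach-sym {X} u∈ (step {v} {w} p w∈ v≢w r) =
    reach-trans (step start (reach-preserves (_∈ X) (λ _ _ _ v∈ _ _ → v∈) u∈ u∈ p) (v≢w ∘ sym) (R-sym r)) (reach-sym u∈ p)

  connected-extend : {C : Subset n} → ConnectedBy R C → ∀ {u v} → u ∈ C → u ≢ v → R u v → ConnectedBy R (C ∪ ⁅ v ⁆)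
  connected-extend {C} conn {u} {v} u∈ u≢v r x y x∈ y∈ =
    reach-trans (reach-sym (p⊆p∪q ⁅ v ⁆ u∈) (from x∈)) (from y∈)
    where
    from : ∀ {x} → x ∈ C ∪ ⁅ v ⁆ → Reach R (C ∪ ⁅ v ⁆) u x
    from x∈ with x∈p∪q⁻ C ⁅ v ⁆ x∈
    ... | inj₁ x∈C = reach-mono (p⊆p∪q ⁅ v ⁆) (conn u _ u∈ x∈C)
    ... | inj₂ x∈v rewrite x∈⁅y⁆⇒x≡y v x∈v = step start (q⊆p∪q C ⁅ v ⁆ (x∈⁅x⁆ v)) u≢v r

  -- Otherwise `C ∪ ⁅ v ⁆` would be a larger connected subset of `Y`, against maximality.
  component-closed : {Y C : Subset n} → IsComponentBy R Y C → ∀ u v → u ∈ C → v ∈ Y → R u v → v ∈ C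
  component-closed {Y} {C} (C⊆Y , _ , conn , maximal) u v u∈ v∈ r with v ∈? C
  ... | yes v∈C = v∈C
  ... | no v∉C = maximal (C ∪ ⁅ v ⁆) (p⊆p∪q ⁅ v ⁆)
    (λ x∈ → [ C⊆Y , (λ x∈v → subst (_∈ Y) (sym (x∈⁅y⁆⇒x≡y v x∈v)) v∈) ]′ (x∈p∪q⁻ C ⁅ v ⁆ x∈))
    (connected-extend conn u∈ (λ { refl → v∉C u∈ }) r)
    (q⊆p∪q C ⁅ v ⁆ (x∈⁅x⁆ v))

  -- Grows a singleton across leaving edges, which must stop in a finite set. Once no edge leaves
  -- `C` inside `Y`, a connected `D` with `C ⊆ D ⊆ Y` cannot reach beyond `C`, and this is
  -- maximality.
  component : (∀ u v → Dec (R u v)) → (Y : Subset n) → ∀ {v} → v ∈ Y → ∃ λ C → v ∈ C × IsComponentBy R Y C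
  component R? Y {x} x∈Y = grow ⁅ x ⁆ (⊃-wellFounded _) (x∈⁅x⁆ x)
    (λ v∈ → subst (_∈ Y) (sym (x∈⁅y⁆⇒x≡y x v∈)) x∈Y)
    (λ u v u∈ v∈ → subst (Reach R _ u) (trans (x∈⁅y⁆⇒x≡y x u∈) (sym (x∈⁅y⁆⇒x≡y x v∈))) start)
    where
    grow : (C : Subset n) → Acc (λ p q → q Data.Fin.Subset.⊂ p) C → x ∈ C → C ⊆ Y → ConnectedBy R C →
           ∃ λ D → x ∈ D × IsComponentBy R Y D
    grow C (acc rs) x∈C C⊆Y conn
      with any? (λ u → any? (λ v → (u ∈? C) ×-dec ((v ∈? Y) ×-dec (¬? (v ∈? C) ×-dec R? u v))))
    ... | yes (u , v , u∈ , v∈Y , v∉C , r) =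
      grow (C ∪ ⁅ v ⁆) (rs (p⊆p∪q ⁅ v ⁆ , v , q⊆p∪q C ⁅ v ⁆ (x∈⁅x⁆ v) , v∉C)) (p⊆p∪q ⁅ v ⁆ x∈C)
        (λ w∈ → [ C⊆Y , (λ w∈v → subst (_∈ Y) (sym (x∈⁅y⁆⇒x≡y v w∈v)) v∈Y) ]′ (x∈p∪q⁻ C ⁅ v ⁆ w∈))
        (connected-extend conn u∈ (λ { refl → v∉C u∈ }) r)
    ... | no none = C , x∈C , C⊆Y , (x , x∈C) , conn , λ D C⊆D D⊆Y connD {d} d∈ →
      reach-preserves (_∈ C) (stay D⊆Y) (C⊆D x∈C) x∈C (connD x d (C⊆D x∈C) d∈)
      where
      stay : ∀ {D} → D ⊆ Y → ∀ u v → u ∈ D → v ∈ D → u ∈ C → R u v → v ∈ C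
      stay D⊆Y u v _ v∈D u∈C r with v ∈? C
      ... | yes v∈C = v∈C
      ... | no v∉C = ⊥-elim (none (u , v , u∈C , D⊆Y v∈D , v∉C , r))

-- Paths and holes, indexed by natural numbers

-- Values beyond `ℓ` are junk. Indexing by `ℕ` makes prepending a vertex a pattern match and keeps
-- the arithmetic of shortest paths free of `Fin`.
record IsPathℕ (T : Trigraph n) (ℓ : ℕ) (q : ℕ → Fin n) : Set where
  field
    distinct  : ∀ {i j} → i < j → j ≤ ℓ → q i ≢ q j
    consec    : ∀ {i} → i < ℓ → Adj T (q i) (q (suc i))
    nonconsec : ∀ {i j} → suc i < j → j ≤ ℓ → Antiadj T (q i) (q j)

infixr 5 _◂_
_◂_ : Fin n → (ℕ → Fin n) → ℕ → Fin n
(x ◂ q) zero    = x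
(x ◂ q) (suc i) = q i

clamp : ∀ ℓ → ℕ → Fin (suc ℓ)
clamp ℓ       zero    = fzero
clamp zero    (suc i) = fzero
clamp (suc ℓ) (suc i) = fsuc (clamp ℓ i)

toℕ-clamp : ∀ {ℓ i} → i ≤ ℓ → toℕ (clamp ℓ i) ≡ i
toℕ-clamp z≤n       = refl
toℕ-clamp (s≤s i≤ℓ) = cong suc (toℕ-clamp i≤ℓ)

clamp-last : ∀ ℓ → clamp ℓ ℓ ≡ fromℕ ℓ
clamp-last zero    = refl
clamp-last (suc ℓ) = cong fsuc (clamp-last ℓ)

IsPath⇒IsPathℕ : {T : Trigraph n} {p : Fin (suc ℓ) → Fin n} → IsPath T ℓ p → IsPathℕ T ℓ (p ∘ clamp ℓ)
IsPath⇒IsPathℕ {ℓ = ℓ} P = record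
  { distinct  = λ {i} {j} i<j j≤ℓ e → ℕₚ.<⇒≢ i<j
      (trans (sym (toℕ-clamp (ℕₚ.≤-trans (ℕₚ.<⇒≤ i<j) j≤ℓ))) (trans (cong toℕ (P.distinct _ _ e)) (toℕ-clamp j≤ℓ)))
  ; consec    = λ i<ℓ → P.consec _ _ (trans (cong suc (toℕ-clamp (ℕₚ.<⇒≤ i<ℓ))) (sym (toℕ-clamp i<ℓ)))
  ; nonconsec = λ {i} {j} i+1<j j≤ℓ → P.nonconsec _ _
      (ℕₚ.≤-trans (s≤s (s≤s (ℕₚ.≤-reflexive (toℕ-clamp (ℕₚ.≤-trans (ℕₚ.n≤1+n i) (ℕₚ.≤-trans (ℕₚ.<⇒≤ i+1<j) j≤ℓ))))))
        (ℕₚ.≤-trans i+1<j (ℕₚ.≤-reflexive (sym (toℕ-clamp j≤ℓ)))))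
  }
  where module P = IsPath P

module _ {T : Trigraph n} {q : ℕ → Fin n} (Q : IsPathℕ T ℓ q) where
  private module Q = IsPathℕ Q

  extend-path : ∀ {x} → Adj T x (q 0) → (∀ {i} → 0 < i → i ≤ ℓ → Antiadj T x (q i)) →
    (∀ {i} → i ≤ ℓ → x ≢ q i) → IsPathℕ T (suc ℓ) (x ◂ q)
  extend-path x~q₀ x≁q x≢q = record
    { distinct  = λ { {zero}  {suc j} _ (s≤s j≤ℓ) → x≢q j≤ℓ
                    ; {suc i} {suc j} (s≤s i<j) (s≤s j≤ℓ) → Q.distinct i<j j≤ℓ }
    ; consec    = λ { {zero} _ → x~q₀ ; {suc i} (s≤s i<ℓ) → Q.consec i<ℓ }
    ; nonconsec = λ { {zero}  {suc j} (s≤s 0<j) (s≤s j≤ℓ) → x≁q 0<j j≤ℓ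
                    ; {suc i} {suc j} (s≤s i+1<j) (s≤s j≤ℓ) → Q.nonconsec i+1<j j≤ℓ }
    }

  -- The cycle consists of `x` at index 0 and the `suc ℓ` vertices of the path. With `x` first, the
  -- index distance `suc ℓ` occurs only between `x` and `q ℓ`; `2 ≤ ℓ` provides the four vertices
  -- that a hole must have.
  close-path : ∀ {x} → 2 ≤ ℓ → Adj T x (q 0) → Adj T x (q ℓ) →
    (∀ {i} → 0 < i → i < ℓ → Antiadj T x (q i)) → (∀ {i} → i ≤ ℓ → x ≢ q i) →
    IsHole T (2 + ℓ) ((x ◂ q) ∘ toℕ)
  close-path {x} 2≤ℓ x~q₀ x~qℓ x≁q x≢q = record
    { big      = s≤s (s≤s 2≤ℓ)
    ; distinct = λ i j e → toℕ-injective (inj i j e)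
    ; adj      = adj′
    ; antiadj  = antiadj′
    }
    where
    h = x ◂ q

    distinct< : ∀ {a b} → a < b → b < 2 + ℓ → h a ≢ h b
    distinct< {zero}  {suc b} _         (s≤s (s≤s b≤ℓ)) = x≢q b≤ℓ
    distinct< {suc a} {suc b} (s≤s a<b) (s≤s (s≤s b≤ℓ)) = Q.distinct a<b b≤ℓ

    adj< : ∀ {a b} → a < b → b < 2 + ℓ → b ∸ a ≡ 1 ⊎ b ∸ a ≡ suc ℓ → Adj T (h a) (h b)
    adj< {zero}  {.1}       _ _ (inj₁ refl) = x~q₀
    adj< {zero}  {.(suc ℓ)} _ _ (inj₂ refl) = x~qℓ
    adj< {suc a} {suc b} (s≤s a<b) (s≤s (s≤s b≤ℓ)) (inj₁ e)
      rewrite sym (trans (sym (cong (_+ a) e)) (ℕₚ.m∸n+n≡m (ℕₚ.<⇒≤ a<b))) = Q.consec b≤ℓ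
    adj< {suc a} {suc b} (s≤s a<b) (s≤s (s≤s b≤ℓ)) (inj₂ e) =
      ⊥-elim (ℕₚ.<-irrefl refl (ℕₚ.≤-trans (ℕₚ.≤-reflexive (sym e)) (ℕₚ.≤-trans (ℕₚ.m∸n≤m b a) b≤ℓ)))

    antiadj< : ∀ {a b} → a < b → b < 2 + ℓ → ¬ (b ∸ a ≡ 1 ⊎ b ∸ a ≡ suc ℓ) → Antiadj T (h a) (h b)
    antiadj< {zero}  {suc zero}    _ _ far = ⊥-elim (far (inj₁ refl))
    antiadj< {zero}  {suc (suc b)} _ (s≤s (s≤s b<ℓ)) far = x≁q z<s (ℕₚ.≤∧≢⇒< b<ℓ (λ { refl → far (inj₂ refl) }))
    antiadj< {suc a} {suc b} (s≤s a<b) (s≤s (s≤s b≤ℓ)) far =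
      Q.nonconsec (ℕₚ.≤∧≢⇒< a<b (λ { refl → far (inj₁ (ℕₚ.m+n∸n≡m 1 a)) })) b≤ℓ

    inj : ∀ (i j : Fin (2 + ℓ)) → h (toℕ i) ≡ h (toℕ j) → toℕ i ≡ toℕ j
    inj i j e with ℕₚ.<-cmp (toℕ i) (toℕ j)
    ... | tri< i<j _ _ = ⊥-elim (distinct< i<j (toℕ<n j) e)
    ... | tri≈ _ i≡j _ = i≡j
    ... | tri> _ _ j<i = ⊥-elim (distinct< j<i (toℕ<n i) (sym e))

    Near : ℕ → Set
    Near d = d ≡ 1 ⊎ d ≡ suc ℓ

    adj′ : ∀ (i j : Fin (2 + ℓ)) → i ≢ j → Near (dist (toℕ i) (toℕ j)) → Adj T (h (toℕ i)) (h (toℕ j))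
    adj′ i j i≢j d with ℕₚ.<-cmp (toℕ i) (toℕ j)
    ... | tri< i<j _ _ = adj< i<j (toℕ<n j) (subst Near (ℕₚ.m≤n⇒∣m-n∣≡n∸m (ℕₚ.<⇒≤ i<j)) d)
    ... | tri≈ _ i≡j _ = ⊥-elim (i≢j (toℕ-injective i≡j))
    ... | tri> _ _ j<i = adj-sym T (adj< j<i (toℕ<n i) (subst Near (ℕₚ.m≤n⇒∣n-m∣≡n∸m (ℕₚ.<⇒≤ j<i)) d))

    antiadj′ : ∀ (i j : Fin (2 + ℓ)) → i ≢ j → ¬ Near (dist (toℕ i) (toℕ j)) → Antiadj T (h (toℕ i)) (h (toℕ j))
    antiadj′ i j i≢j d with ℕₚ.<-cmp (toℕ i) (toℕ j)
    ... | tri< i<j _ _ = antiadj< i<j (toℕ<n j) (d ∘ subst Near (sym (ℕₚ.m≤n⇒∣m-n∣≡n∸m (ℕₚ.<⇒≤ i<j))))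
    ... | tri≈ _ i≡j _ = ⊥-elim (i≢j (toℕ-injective i≡j))
    ... | tri> _ _ j<i = antiadj-sym T (antiadj< j<i (toℕ<n i) (d ∘ subst Near (sym (ℕₚ.m≤n⇒∣n-m∣≡n∸m (ℕₚ.<⇒≤ j<i)))))

  -- From length three on there are at least two interior vertices. This is what shows that an
  -- interior vertex is not isolated in the part of the partition containing the interior.
  interior-neighbour : 3 ≤ ℓ → ∀ {i} → 0 < i → i < ℓ → ∃ λ j → 0 < j × j < ℓ × q i ≢ q j × Adj T (q i) (q j)
  interior-neighbour 3≤ℓ {suc zero} _ 1<ℓ = 2 , z<s , 3≤ℓ , Q.distinct ℕₚ.≤-refl 1<ℓ , Q.consec 1<ℓ
  interior-neighbour 3≤ℓ {suc (suc i)} _ i<ℓ = suc i , z<s , ℕₚ.<⇒≤ i<ℓ ,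
    Q.distinct ℕₚ.≤-refl (ℕₚ.<⇒≤ i<ℓ) ∘ sym , adj-sym T (Q.consec (ℕₚ.<⇒≤ i<ℓ))

interior-induction : (P : ℕ → Set) → P 1 → (∀ {i} → 0 < i → suc i < ℓ → P i → P (suc i)) → ∀ {i} → 0 < i → i < ℓ → P i
interior-induction P P₁ s {suc zero}    _ _   = P₁
interior-induction P P₁ s {suc (suc i)} _ i<ℓ = s z<s i<ℓ (interior-induction P P₁ s z<s (ℕₚ.<⇒≤ i<ℓ))

odd⇒3≤ : Odd ℓ → 1 < ℓ → 3 ≤ ℓ
odd⇒3≤ (zero  , refl) (s≤s ())
odd⇒3≤ (suc m , refl) _ rewrite ℕₚ.+-suc m (m + 0) = s≤s (s≤s (s≤s z≤n))

odd-2+ : Odd ℓ → Odd (2 + ℓ)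
odd-2+ (m , refl) = suc m , cong (suc ∘ suc) (sym (ℕₚ.+-suc m (m + 0)))

-- Closing a path of length `ℓ` gives `ℓ + 2` vertices, so parity is kept; with `compl T` in place
-- of `T` the result is an odd antihole. Every odd hole or antihole below arises here.
no-odd-closure : {T : Trigraph n} {q : ℕ → Fin n} → (∀ k (h : Fin k → Fin n) → IsHole T k h → Odd k → ⊥) →
  IsPathℕ T ℓ q → Odd ℓ → 2 ≤ ℓ → ∀ {x} → Adj T x (q 0) → Adj T x (q ℓ) →
  (∀ {i} → 0 < i → i < ℓ → Antiadj T x (q i)) → (∀ {i} → i ≤ ℓ → x ≢ q i) → ⊥
no-odd-closure no-hole Q odd 2≤ℓ x~ x~′ x≁ x≢ = no-hole _ _ (close-path Q 2≤ℓ x~ x~′ x≁ x≢) (odd-2+ odd)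

∁-involutive : (p : Subset n) → ∁ (∁ p) ≡ p
∁-involutive []ᵥ             = refl
∁-involutive (inside  ∷ᵥ p) = cong (inside ∷ᵥ_) (∁-involutive p)
∁-involutive (outside ∷ᵥ p) = cong (outside ∷ᵥ_) (∁-involutive p)

-- Trigraphs in 𝓕 without balanced skew-partition

-- The consequences of the hypotheses on which the rest relies, in a form that passes to the
-- complement by `tame-compl`, so that each later lemma is also available for `compl T`.
record Tame (T : Trigraph n) : Set where
  field
    no-odd-hole     : ∀ k (h : Fin k → Fin n) → IsHole T k h → Odd k → ⊥
    no-odd-antihole : ∀ k (h : Fin k → Fin n) → IsAntihole T k h → Odd k → ⊥
    switch-degree≤2 : ∀ v x y z → x ≢ v → y ≢ v → z ≢ v → x ≢ y → x ≢ z → y ≢ z →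
                      Switch T v x → Switch T v y → Switch T v z → ⊥
    switch-degree2  : ∀ v x y → x ≢ y → x ≢ v → y ≢ v → Switch T v x → Switch T v y →
                      (∀ z → z ≢ v → z ≢ x → z ≢ y → StrAdj T v z) ⊎ (∀ z → z ≢ v → z ≢ x → z ≢ y → StrAnti T v z)
    no-balanced     : ¬ HasBalancedSkewPartition T

-- `compl (compl T)` is not definitionally `T`, because `negT (negT t)` is stuck on a neutral `t`;
-- holes and paths have to be transported by hand.
holeᶜᶜ : {T : Trigraph n} {k : ℕ} {h : Fin k → Fin n} → IsHole (compl (compl T)) k h → IsHole T k h
holeᶜᶜ H = record
  { big = H.big ; distinct = H.distinct
  ; adj = λ i j i≢j d → antiᶜ⇒adj (adjᶜ⇒anti (H.adj i j i≢j d))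
  ; antiadj = λ i j i≢j d → adjᶜ⇒anti (antiᶜ⇒adj (H.antiadj i j i≢j d)) }
  where module H = IsHole H

pathᶜᶜ : {T : Trigraph n} {p : Fin (suc ℓ) → Fin n} → IsPath T ℓ p → IsPath (compl (compl T)) ℓ p
pathᶜᶜ P = record
  { distinct = P.distinct
  ; consec = λ i j e → anti⇒adjᶜ (adj⇒antiᶜ (P.consec i j e))
  ; nonconsec = λ i j e → adj⇒antiᶜ (anti⇒adjᶜ (P.nonconsec i j e)) }
  where module P = IsPath P

reach-map : {R S : Fin n → Fin n → Set} {X : Subset n} → (∀ {u v} → R u v → S u v) → ∀ {u v} → Reach R X u v → Reach S X u v
reach-map f start              = start
reach-map f (step p w∈ v≢w r) = step (reach-map f p) w∈ v≢w (f r)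

-- Complementation exchanges paths with antipaths and connected with anticonnected sets, so the two
-- parts of the partition change places.
balanced-compl : {T : Trigraph n} → HasBalancedSkewPartition (compl T) → HasBalancedSkewPartition T
balanced-compl {T = T} (A , (¬conn , ¬anti) , no-path , no-antipath) =
  ∁ A , ((λ c → ¬anti (λ u v u∈ v∈ → reach-map adj⇒antiᶜ (c u v u∈ v∈)))
        , λ c → ¬conn (λ u v u∈ v∈ → reach-map anti⇒adjᶜ
            (subst (λ X → Reach (Antiadj T) X u v) (∁-involutive A) (c u v (∈∁∁ u∈) (∈∁∁ v∈)))))
  , (λ ℓ p P o 1<ℓ p₀ pₗ int → no-antipath ℓ p (pathᶜᶜ P) o 1<ℓ (∁∁∈ p₀) (∁∁∈ pₗ) int)
  , (λ ℓ p P o 1<ℓ p₀ pₗ int → no-path ℓ p P o 1<ℓ p₀ pₗ (λ i 0<i i<ℓ → ∁∁∈ (int i 0<i i<ℓ)))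
  where
  ∈∁∁ : ∀ {v} → v ∈ A → v ∈ ∁ (∁ A)
  ∈∁∁ {v} = subst (v ∈_) (sym (∁-involutive A))
  ∁∁∈ : ∀ {v} → v ∈ ∁ (∁ A) → v ∈ A
  ∁∁∈ {v} = subst (v ∈_) (∁-involutive A)

tame-compl : {T : Trigraph n} → Tame T → Tame (compl T)
tame-compl {T = T} G = record
  { no-odd-hole     = G.no-odd-antihole
  ; no-odd-antihole = λ k h H → G.no-odd-hole k h (holeᶜᶜ H)
  ; switch-degree≤2 = λ v x y z ≢1 ≢2 ≢3 ≢4 ≢5 ≢6 a b c →
      G.switch-degree≤2 v x y z ≢1 ≢2 ≢3 ≢4 ≢5 ≢6 (negT-injective a) (negT-injective b) (negT-injective c)
  ; switch-degree2  = λ v x y ≢1 ≢2 ≢3 a b →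
      [ (λ h → inj₂ (λ z z≢v z≢x z≢y → cong negT (h z z≢v z≢x z≢y)))
      , (λ h → inj₁ (λ z z≢v z≢x z≢y → cong negT (h z z≢v z≢x z≢y))) ]′
      (G.switch-degree2 v x y ≢1 ≢2 ≢3 (negT-injective a) (negT-injective b))
  ; no-balanced     = G.no-balanced ∘ balanced-compl
  }
  where module G = Tame G

three-distinct : {A : Set} {xs : List A} {x y z : A} → x ≢ y → x ≢ z → y ≢ z →
  x List.∈ xs → y List.∈ xs → z List.∈ xs → 3 ≤ length xs
three-distinct {xs = xs} x≢y x≢z y≢z x∈ y∈ z∈ = go (index x∈) (index y∈) (index z∈)
  (λ e → x≢y (same x∈ y∈ e)) (λ e → x≢z (same x∈ z∈ e)) (λ e → y≢z (same y∈ z∈ e))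
  where
  same : ∀ {u v} (u∈ : u List.∈ xs) (v∈ : v List.∈ xs) → index u∈ ≡ index v∈ → u ≡ v
  same u∈ v∈ e = trans (lookup-index u∈) (trans (cong (lookup xs) e) (sym (lookup-index v∈)))
  go : ∀ {m} (i j k : Fin m) → i ≢ j → i ≢ k → j ≢ k → 3 ≤ m
  go {suc zero} fzero fzero _ i≢j _ _ = ⊥-elim (i≢j refl)
  go {suc (suc zero)} fzero        fzero        _            i≢j _ _ = ⊥-elim (i≢j refl)
  go {suc (suc zero)} (fsuc fzero) (fsuc fzero) _            i≢j _ _ = ⊥-elim (i≢j refl)
  go {suc (suc zero)} fzero        (fsuc fzero) fzero        _ i≢k _ = ⊥-elim (i≢k refl)
  go {suc (suc zero)} fzero        (fsuc fzero) (fsuc fzero) _ _ j≢k = ⊥-elim (j≢k refl)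
  go {suc (suc zero)} (fsuc fzero) fzero        fzero        _ _ j≢k = ⊥-elim (j≢k refl)
  go {suc (suc zero)} (fsuc fzero) fzero        (fsuc fzero) _ i≢k _ = ⊥-elim (i≢k refl)
  go {suc (suc (suc m))} _ _ _ _ _ _ = s≤s (s≤s (s≤s z≤n))

-- `switchEdgesIn` lists an edge once, with the smaller index first; this is that representative.
sorted : Fin n → Fin n → Fin n × Fin n
sorted u v with toℕ u ℕₚ.<? toℕ v
... | yes _ = u , v
... | no _  = v , u

sorted-injective : {v x y : Fin n} → x ≢ v → y ≢ v → sorted v x ≡ sorted v y → x ≡ y
sorted-injective {v = v} {x} {y} x≢v y≢v e with toℕ v ℕₚ.<? toℕ x | toℕ v ℕₚ.<? toℕ y | e
... | yes _ | yes _ | refl = refl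
... | yes _ | no _  | refl = ⊥-elim (y≢v refl)
... | no _  | yes _ | refl = ⊥-elim (y≢v refl)
... | no _  | no _  | refl = refl

InF⇒Tame : {T : Trigraph n} → InF T → ¬ HasBalancedSkewPartition T → Tame T
InF⇒Tame {n} {T} ((no-odd-hole , no-odd-antihole) , few , deg2) no-balanced = record
  { no-odd-hole     = no-odd-hole
  ; no-odd-antihole = no-odd-antihole
  ; switch-degree≤2 = deg≤2
  ; switch-degree2  = λ v x y x≢y x≢v y≢v vx vy →
      [ inj₁ ∘ proj₁ , inj₂ ∘ proj₁ ]′ (deg2 v x y x≢y x≢v y≢v vx vy (third x≢y x≢v y≢v vx vy))
  ; no-balanced     = no-balanced
  }
  where
  -- Three switchable pairs at `v` would be three edges of the component of `v` in Σ(T), which has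
  -- at most two.
  deg≤2 : ∀ v x y z → x ≢ v → y ≢ v → z ≢ v → x ≢ y → x ≢ z → y ≢ z →
          Switch T v x → Switch T v y → Switch T v z → ⊥
  deg≤2 v x y z x≢v y≢v z≢v x≢y x≢z y≢z vx vy vz
    with Components.component (Switch T) (θ-flip T) (λ u w → θ T u w ≟T zer) V (x∉p⇒x∈∁p {x = v} ∉⊥)
  ... | C , v∈C , isC = ℕₚ.<-irrefl refl (ℕₚ.≤-trans
    (three-distinct (x≢y ∘ sorted-injective x≢v y≢v) (x≢z ∘ sorted-injective x≢v z≢v) (y≢z ∘ sorted-injective y≢v z≢v)
      (edge x≢v vx) (edge y≢v vy) (edge z≢v vz)) (few C isC))
    where
    Edge? : ∀ (uv : Fin n × Fin n) → Dec _
    Edge? uv = (toℕ (proj₁ uv) ℕₚ.<? toℕ (proj₂ uv)) ×-dec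
               ((proj₁ uv ∈? C) ×-dec ((proj₂ uv ∈? C) ×-dec (θ T (proj₁ uv) (proj₂ uv) ≟T zer)))
    edge : ∀ {w} → w ≢ v → Switch T v w → sorted v w List.∈ filter Edge? (cartesianProduct (allFin n) (allFin n))
    edge {w} w≢v vw = ∈-filter⁺ Edge? (∈-cartesianProduct⁺ (∈-allFin _) (∈-allFin _)) is-edge
      where
      w∈C : w ∈ C
      w∈C = Components.component-closed (Switch T) (θ-flip T) isC v w v∈C (x∉p⇒x∈∁p ∉⊥) vw
      is-edge : let uv = sorted v w in toℕ (proj₁ uv) < toℕ (proj₂ uv) ×
                (proj₁ uv ∈ C × (proj₂ uv ∈ C × θ T (proj₁ uv) (proj₂ uv) ≡ zer))
      is-edge with toℕ v ℕₚ.<? toℕ w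
      ... | yes v<w = v<w , v∈C , w∈C , vw
      ... | no v≮w  = ℕₚ.≤∧≢⇒< (ℕₚ.≮⇒≥ v≮w) (w≢v ∘ toℕ-injective) , w∈C , v∈C , θ-flip T vw
  third : ∀ {v x y} → x ≢ y → x ≢ v → y ≢ v → Switch T v x → Switch T v y → ∀ z → z ≢ v → Switch T v z → z ≡ x ⊎ z ≡ y
  third {v} {x} {y} x≢y x≢v y≢v vx vy z z≢v vz with z ≟ x | z ≟ y
  ... | yes e | _     = inj₁ e
  ... | no _  | yes e = inj₂ e
  ... | no z≢x | no z≢y = ⊥-elim (deg≤2 v x y z x≢v y≢v z≢v x≢y (z≢x ∘ sym) (z≢y ∘ sym) vx vy vz)

-- Balanced skew-partitions

balancedℕ : (T : Trigraph n) (A : Subset n) →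
  (∀ {ℓ q} → IsPathℕ T ℓ q → Odd ℓ → 3 ≤ ℓ → q 0 ∈ ∁ A → q ℓ ∈ ∁ A → (∀ {i} → 0 < i → i < ℓ → q i ∈ A) → ⊥) →
  (∀ {ℓ q} → IsPathℕ (compl T) ℓ q → Odd ℓ → 3 ≤ ℓ → q 0 ∈ A → q ℓ ∈ A → (∀ {i} → 0 < i → i < ℓ → q i ∈ ∁ A) → ⊥) →
  BalancedSkew T A
balancedℕ {n} T A no-path no-antipath =
    (λ ℓ p P o 1<ℓ p₀ pₗ int → no-path (IsPath⇒IsPathℕ P) o (odd⇒3≤ o 1<ℓ) p₀ (last p (∁ A) pₗ) (interior p A int))
  , (λ ℓ p P o 1<ℓ p₀ pₗ int → no-antipath (IsPath⇒IsPathℕ P) o (odd⇒3≤ o 1<ℓ) p₀ (last p A pₗ) (interior p (∁ A) int))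
  where
  last : ∀ {ℓ} (p : Fin (suc ℓ) → Fin n) (X : Subset n) → p (fromℕ ℓ) ∈ X → p (clamp ℓ ℓ) ∈ X
  last {ℓ} p X = subst (λ i → p i ∈ X) (sym (clamp-last ℓ))
  interior : ∀ {ℓ} (p : Fin (suc ℓ) → Fin n) (X : Subset n) → (∀ i → 0 < toℕ i → toℕ i < ℓ → p i ∈ X) →
             ∀ {i} → 0 < i → i < ℓ → p (clamp ℓ i) ∈ X
  interior {ℓ} p X int {i} 0<i i<ℓ = int (clamp ℓ i) (subst (0 <_) (sym e) 0<i) (subst (_< ℓ) (sym e) i<ℓ)
    where e = toℕ-clamp (ℕₚ.<⇒≤ i<ℓ)

separated⇒¬connected : {R : Fin n → Fin n → Set} {X : Subset n} (P : Fin n → Set) →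
  (∀ u v → u ∈ X → v ∈ X → P u → R u v → P v) → ∀ {u v} → u ∈ X → P u → v ∈ X → ¬ P v → ¬ ConnectedBy R X
separated⇒¬connected P closed u∈ pu v∈ ¬pv conn = ¬pv (reach-preserves P closed u∈ pu (conn _ _ u∈ v∈))

-- Star cutsets

data Part : Set where
  centre leaf left right : Part

data InRest : Part → Set where
  inLeft  : InRest left
  inRight : InRest right

inRest? : ∀ p → Dec (InRest p)
inRest? centre = no λ ()
inRest? leaf   = no λ ()
inRest? left   = yes inLeft
inRest? right  = yes inRight

-- In a balance-violating path or antipath no vertex of the cut-off side is isolated
-- there, so the centre x closes it to an odd hole or antihole.
module _ {T : Trigraph n} (G : Tame T) (x : Fin n) (g : Fin n → Part)
  (gx : g x ≡ centre) (centre-x : ∀ v → g v ≡ centre → v ≡ x)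
  (leaf-adj : ∀ v → g v ≡ leaf → StrAdj T x v)
  (sep : ∀ u v → g u ≡ left → g v ≡ right → StrAnti T u v)
  {y l r : Fin n} (gy : g y ≡ leaf) (gl : g l ≡ left) (gr : g r ≡ right)
  (iso : ∀ v → InRest (g v) → Antiadj T x v ⊎ (∀ w → InRest (g w) → v ≢ w → StrAnti T v w))
  where
  private
    module G = Tame G

    A? : ∀ v → Dec (InRest (g v))
    A? v = inRest? (g v)

    A : Subset n
    A = select A?

    ∁A-view : ∀ {v} → v ∈ ∁ A → v ≡ x ⊎ g v ≡ leaf
    ∁A-view {v} v∈ with g v in e | ∁-select⁻ A? {v} v∈
    ... | centre | _ = inj₁ (centre-x v e)
    ... | leaf   | _ = inj₂ refl
    ... | left   | h = ⊥-elim (h inLeft)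
    ... | right  | h = ⊥-elim (h inRight)

    x∉A : ∀ {v} → v ∈ A → x ≢ v
    x∉A {v} v∈ refl with subst InRest gx (∈-select⁻ A? v∈)
    ... | ()

    x∉leaf : ∀ {v} → g v ≡ leaf → x ≢ v
    x∉leaf e refl = case trans (sym gx) e of λ ()

    side : ∀ u v → u ∈ A → v ∈ A → g u ≡ left → Adj T u v → g v ≡ left
    side u v _ v∈ gu u~v with g v in e | ∈-select⁻ A? {v} v∈
    ... | left   | _ = refl
    ... | right  | _ = ⊥-elim (neg-adj (sep u v gu e) u~v)

    antiadj-x : ∀ {v w} → v ∈ A → w ∈ A → v ≢ w → Adj T v w → Antiadj T x v
    antiadj-x {v} {w} v∈ w∈ v≢w v~w with iso v (∈-select⁻ A? v∈)
    ... | inj₁ a = a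
    ... | inj₂ h = ⊥-elim (neg-adj (h w (∈-select⁻ A? w∈) v≢w) v~w)

    -- The centre is strongly adjacent to every leaf, so it has no antineighbour among the other
    -- vertices of the star.
    leaf-of-nonadjacent : ∀ {v w} → v ∈ ∁ A → w ∈ ∁ A → v ≢ w → Antiadj T v w → g v ≡ leaf
    leaf-of-nonadjacent {v} {w} v∈ w∈ v≢w v≁w with ∁A-view v∈ | ∁A-view w∈
    ... | inj₂ e    | _         = e
    ... | inj₁ refl | inj₁ refl = ⊥-elim (v≢w refl)
    ... | inj₁ refl | inj₂ e    = ⊥-elim (pos-anti (leaf-adj w e) v≁w)

    no-path : ∀ {ℓ q} → IsPathℕ T ℓ q → Odd ℓ → 3 ≤ ℓ → q 0 ∈ ∁ A → q ℓ ∈ ∁ A →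
              (∀ {i} → 0 < i → i < ℓ → q i ∈ A) → ⊥
    no-path {ℓ} {q} Q odd 3≤ℓ q₀ qₗ int =
      no-odd-closure G.no-odd-hole Q odd (ℕₚ.<⇒≤ 3≤ℓ)
        (inj₂ (leaf-adj _ leaf₀)) (inj₂ (leaf-adj _ leafₗ))
        (λ 0<i i<ℓ → let j , 0<j , j<ℓ , ≢ᵢⱼ , ~ᵢⱼ = interior-neighbour Q 3≤ℓ 0<i i<ℓ in
           antiadj-x (int 0<i i<ℓ) (int 0<j j<ℓ) ≢ᵢⱼ ~ᵢⱼ)
        x≢q
      where
      module Q = IsPathℕ Q
      0<ℓ = ℕₚ.<-trans z<s (ℕₚ.<⇒≤ 3≤ℓ)
      leaf₀ : g (q 0) ≡ leaf
      leaf₀ = leaf-of-nonadjacent q₀ qₗ (Q.distinct 0<ℓ ℕₚ.≤-refl) (Q.nonconsec (ℕₚ.<⇒≤ 3≤ℓ) ℕₚ.≤-refl)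
      leafₗ : g (q ℓ) ≡ leaf
      leafₗ = leaf-of-nonadjacent qₗ q₀ (Q.distinct 0<ℓ ℕₚ.≤-refl ∘ sym)
                (antiadj-sym T (Q.nonconsec (ℕₚ.<⇒≤ 3≤ℓ) ℕₚ.≤-refl))
      x≢q : ∀ {i} → i ≤ ℓ → x ≢ q i
      x≢q {zero} _ = x∉leaf leaf₀
      x≢q {suc i} i<ℓ with ℕₚ.m≤n⇒m<n∨m≡n i<ℓ
      ... | inj₁ 1+i<ℓ = x∉A (int z<s 1+i<ℓ)
      ... | inj₂ refl  = x∉leaf leafₗ

    no-antipath : ∀ {ℓ q} → IsPathℕ (compl T) ℓ q → Odd ℓ → 3 ≤ ℓ → q 0 ∈ A → q ℓ ∈ A →
              (∀ {i} → 0 < i → i < ℓ → q i ∈ ∁ A) → ⊥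
    -- The ends of an antipath of length at least three are adjacent in `T`. Hence neither is
    -- isolated in `A`, and both are antiadjacent to `x`; the interior consists of leaves.
    no-antipath {ℓ} {q} Q odd 3≤ℓ q₀ qₗ int =
      no-odd-closure {T = compl T} G.no-odd-antihole Q odd (ℕₚ.<⇒≤ 3≤ℓ)
        (anti⇒adjᶜ (antiadj-x q₀ qₗ ≢₀ₗ ~₀ₗ))
        (anti⇒adjᶜ (antiadj-x qₗ q₀ (≢₀ₗ ∘ sym) (adj-sym T ~₀ₗ)))
        (λ 0<i i<ℓ → inj₁ (cong negT (leaf-adj _ (leafᵢ 0<i i<ℓ))))
        x≢q
      where
      module Q = IsPathℕ Q
      ≢₀ₗ : q 0 ≢ q ℓ
      ≢₀ₗ = Q.distinct (ℕₚ.<-trans z<s (ℕₚ.<⇒≤ 3≤ℓ)) ℕₚ.≤-refl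
      ~₀ₗ : Adj T (q 0) (q ℓ)
      ~₀ₗ = antiᶜ⇒adj (Q.nonconsec (ℕₚ.<⇒≤ 3≤ℓ) ℕₚ.≤-refl)
      leafᵢ : ∀ {i} → 0 < i → i < ℓ → g (q i) ≡ leaf
      leafᵢ 0<i i<ℓ with interior-neighbour Q 3≤ℓ 0<i i<ℓ
      ... | j , 0<j , j<ℓ , ≢ᵢⱼ , ~ᵢⱼ = leaf-of-nonadjacent (int 0<i i<ℓ) (int 0<j j<ℓ) ≢ᵢⱼ (adjᶜ⇒anti ~ᵢⱼ)
      x≢q : ∀ {i} → i ≤ ℓ → x ≢ q i
      x≢q {zero} _ = x∉A q₀
      x≢q {suc i} i<ℓ with ℕₚ.m≤n⇒m<n∨m≡n i<ℓ
      ... | inj₁ 1+i<ℓ = x∉leaf (leafᵢ z<s 1+i<ℓ)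
      ... | inj₂ refl  = x∉A qₗ

  no-reduced-star : ⊥
  no-reduced-star = G.no-balanced (A ,
    ( separated⇒¬connected (λ v → g v ≡ left) side
        (∈-select⁺ A? (subst InRest (sym gl) inLeft)) gl
        (∈-select⁺ A? (subst InRest (sym gr) inRight)) (λ e → case trans (sym gr) e of λ ())
    -- Being strongly complete to the leaves, `x` has no antineighbour to move to; the leaf `y`
    -- shows that the star is larger than {x}.
    , separated⇒¬connected (_≡ x) stay
        (∁-select⁺ A? (λ h → case subst InRest gx h of λ ())) refl
        (∁-select⁺ A? (λ h → case subst InRest gy h of λ ())) (x∉leaf gy ∘ sym) )
    , balancedℕ T A no-path no-antipath)
    where
    stay : ∀ u v → u ∈ ∁ A → v ∈ ∁ A → u ≡ x → Antiadj T u v → v ≡ x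
    stay u v _ v∈ refl u≁v with ∁A-view v∈
    ... | inj₁ e = e
    ... | inj₂ e = ⊥-elim (pos-anti (leaf-adj v e) u≁v)

-- Chvátal's argument: absorb into the star every strong neighbour of x, keeping one vertex
-- of a side consisting only of such neighbours; every remaining vertex is then
-- antiadjacent to x or isolated in the rest.
module _ {T : Trigraph n} (G : Tame T) (x : Fin n) (f : Fin n → Part)
  (fx : f x ≡ centre) (centre-x : ∀ v → f v ≡ centre → v ≡ x)
  (leaf-adj : ∀ v → f v ≡ leaf → StrAdj T x v)
  (sep : ∀ u v → f u ≡ left → f v ≡ right → StrAnti T u v)
  {y : Fin n} (fy : f y ≡ leaf) where
  private
    -- `k` is the vertex by which side `p` survives the absorption: one that is no strong neighbour
    -- of `x` if there is any, and otherwise an arbitrary one, together with the fact that the whole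
    -- side could be absorbed.
    Kept : Part → Fin n → Set
    Kept p k = f k ≡ p × (¬ StrAdj T x k ⊎ (∀ v → f v ≡ p → StrAdj T x v))

    _≟P_ : (p q : Part) → Dec (p ≡ q)
    centre ≟P centre = yes refl
    centre ≟P leaf   = no λ ()
    centre ≟P left   = no λ ()
    centre ≟P right  = no λ ()
    leaf   ≟P centre = no λ ()
    leaf   ≟P leaf   = yes refl
    leaf   ≟P left   = no λ ()
    leaf   ≟P right  = no λ ()
    left   ≟P centre = no λ ()
    left   ≟P leaf   = no λ ()
    left   ≟P left   = yes refl
    left   ≟P right  = no λ ()
    right  ≟P centre = no λ ()
    right  ≟P leaf   = no λ ()
    right  ≟P left   = no λ ()
    right  ≟P right  = yes refl

    choose : ∀ p {k} → f k ≡ p → ∃ (Kept p)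
    choose p {k} fk with any? (λ v → (f v ≟P p) ×-dec ¬? (θ T x v ≟T pos))
    ... | yes (v , fv , ¬xv) = v , fv , inj₁ ¬xv
    ... | no none = k , fk , inj₂ all
      where
      all : ∀ v → f v ≡ p → StrAdj T x v
      all v fv with θ T x v ≟T pos
      ... | yes xv = xv
      ... | no ¬xv = ⊥-elim (none (v , fv , ¬xv))

    module Reduce {l r : Fin n} (kl : Kept left l) (kr : Kept right r) where
      Keep : Fin n → Set
      Keep v = ¬ StrAdj T x v ⊎ (v ≡ l ⊎ v ≡ r)

      keep? : ∀ v → Dec (Keep v)
      keep? v = ¬? (θ T x v ≟T pos) ⊎-dec ((v ≟ l) ⊎-dec (v ≟ r))

      -- Vertices of the two sides that fail `Keep` become leaves; they are strong neighbours of
      -- `x`, so the result is again a star, with both sides still nonempty thanks to `l` and `r`.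
      g : Fin n → Part
      g v with keep? v | inRest? (f v)
      ... | no _ | yes _ = leaf
      ... | _    | _     = f v

      g-keep : ∀ {v} → Keep v → g v ≡ f v
      g-keep {v} k with keep? v | inRest? (f v)
      ... | yes _ | _     = refl
      ... | no ¬k | _     = ⊥-elim (¬k k)

      g-outer : ∀ {v} → ¬ InRest (f v) → g v ≡ f v
      g-outer {v} h with keep? v | inRest? (f v)
      ... | yes _ | _     = refl
      ... | no _  | no _  = refl
      ... | no _  | yes i = ⊥-elim (h i)

      g-rest : ∀ {v p} → InRest p → g v ≡ p → f v ≡ p × Keep v
      g-rest {v} i e with keep? v | inRest? (f v)
      g-rest i e | yes k | _ = e , k
      g-rest i e | no ¬k | no ¬i = ⊥-elim (¬i (subst InRest (sym e) i))
      g-rest () refl | no ¬k | yes _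

      g-centre : ∀ v → g v ≡ centre → v ≡ x
      g-centre v e with keep? v | inRest? (f v)
      ... | yes _ | _    = centre-x v e
      ... | no _  | no _ = centre-x v e

      g-leaf : ∀ v → g v ≡ leaf → StrAdj T x v
      g-leaf v e with keep? v | inRest? (f v)
      ... | yes _ | _     = leaf-adj v e
      ... | no _  | no _  = leaf-adj v e
      ... | no ¬k | yes _ with θ T x v ≟T pos
      ...   | yes xv = xv
      ...   | no ¬xv = ⊥-elim (¬k (inj₁ ¬xv))

      g-sep : ∀ u v → g u ≡ left → g v ≡ right → StrAnti T u v
      g-sep u v eu ev = sep u v (proj₁ (g-rest inLeft eu)) (proj₁ (g-rest inRight ev))

      -- A surviving strong neighbour of `x` is `l` or `r`, kept because its whole side consists of
      -- strong neighbours. Then the others on that side have become leaves, and the opposite side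
      -- is strongly anticomplete to it.
      iso : ∀ v → InRest (g v) → Antiadj T x v ⊎ (∀ w → InRest (g w) → v ≢ w → StrAnti T v w)
      iso v i with g v in e
      iso v inLeft | left with g-rest inLeft e | proj₂ kl
      ... | fv , inj₁ ¬xv | _ = inj₁ (≢pos⇒anti ¬xv)
      ... | fv , inj₂ (inj₂ refl) | _ = case trans (sym fv) (proj₁ kr) of λ ()
      ... | fv , inj₂ (inj₁ refl) | inj₁ ¬xv = inj₁ (≢pos⇒anti ¬xv)
      ... | fv , inj₂ (inj₁ refl) | inj₂ all = inj₂ alone
        where
        alone : ∀ w → InRest (g w) → v ≢ w → StrAnti T v w
        alone w j v≢w with g w in e′
        alone w inRight v≢w | right = sep v w fv (proj₁ (g-rest inRight e′))
        alone w inLeft v≢w | left with g-rest inLeft e′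
        ... | fw , inj₁ ¬xw = ⊥-elim (¬xw (all w fw))
        ... | fw , inj₂ (inj₁ refl) = ⊥-elim (v≢w refl)
        ... | fw , inj₂ (inj₂ refl) = case trans (sym fw) (proj₁ kr) of λ ()
      iso v inRight | right with g-rest inRight e | proj₂ kr
      ... | fv , inj₁ ¬xv | _ = inj₁ (≢pos⇒anti ¬xv)
      ... | fv , inj₂ (inj₁ refl) | _ = case trans (sym fv) (proj₁ kl) of λ ()
      ... | fv , inj₂ (inj₂ refl) | inj₁ ¬xv = inj₁ (≢pos⇒anti ¬xv)
      ... | fv , inj₂ (inj₂ refl) | inj₂ all = inj₂ alone
        where
        alone : ∀ w → InRest (g w) → v ≢ w → StrAnti T v w
        alone w j v≢w with g w in e′
        alone w inLeft v≢w | left = θ-flip T (sep w v (proj₁ (g-rest inLeft e′)) fv)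
        alone w inRight v≢w | right with g-rest inRight e′
        ... | fw , inj₁ ¬xw = ⊥-elim (¬xw (all w fw))
        ... | fw , inj₂ (inj₂ refl) = ⊥-elim (v≢w refl)
        ... | fw , inj₂ (inj₁ refl) = case trans (sym fw) (proj₁ kl) of λ ()

      contra : ⊥
      contra = no-reduced-star G x g
        (trans (g-outer (λ i → case subst InRest fx i of λ ())) fx) g-centre g-leaf g-sep
        (trans (g-outer (λ i → case subst InRest fy i of λ ())) fy)
        (trans (g-keep (inj₂ (inj₁ refl))) (proj₁ kl))
        (trans (g-keep (inj₂ (inj₂ refl))) (proj₁ kr)) iso

  no-labelled-star : ∀ {l r} → f l ≡ left → f r ≡ right → ⊥
  no-labelled-star fl fr = Reduce.contra (proj₂ (choose left fl)) (proj₂ (choose right fr))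

-- The sets in the cover may overlap; the four given vertices make the parts nonempty.
module _ {T : Trigraph n} (G : Tame T) (x y l r : Fin n) (P Q : Fin n → Set)
  (x≢y : x ≢ y) (x≢l : x ≢ l) (x≢r : x ≢ r) (y≢l : y ≢ l) (y≢r : y ≢ r) (l≢r : l ≢ r)
  (xy : StrAdj T x y) (Pl : P l) (Qr : Q r)
  (cover : ∀ v → v ≢ x → StrAdj T x v ⊎ (P v ⊎ Q v))
  (P≁Q : ∀ u v → P u → Q v → StrAnti T u v) where
  private
    Spec : Part → Fin n → Set
    Spec centre v = v ≡ x
    Spec leaf   v = StrAdj T x v
    Spec left   v = P v
    Spec right  v = Q v

    -- `l` and `r` may be strong neighbours of `x`. They are tested before `cover` is consulted, so
    -- that they are not turned into leaves.
    classify : ∀ v → ∃ λ p → Spec p v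
    classify v with v ≟ x
    ... | yes e = centre , e
    ... | no v≢x with v ≟ y
    ... | yes refl = leaf , xy
    ... | no _ with v ≟ l
    ... | yes refl = left , Pl
    ... | no _ with v ≟ r
    ... | yes refl = right , Qr
    ... | no _ with cover v v≢x
    ... | inj₁ a        = leaf , a
    ... | inj₂ (inj₁ p) = left , p
    ... | inj₂ (inj₂ q) = right , q

    f : Fin n → Part
    f v = proj₁ (classify v)

    spec : ∀ {v p} → f v ≡ p → Spec p v
    spec {v} e = subst (λ p → Spec p v) e (proj₂ (classify v))

    fx : f x ≡ centre
    fx with x ≟ x
    ... | yes _ = refl
    ... | no x≢x = ⊥-elim (x≢x refl)

    fy : f y ≡ leaf
    fy with y ≟ x
    ... | yes e = ⊥-elim (x≢y (sym e))
    ... | no _ with y ≟ y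
    ... | yes refl = refl
    ... | no y≢y = ⊥-elim (y≢y refl)

    fl : f l ≡ left
    fl with l ≟ x
    ... | yes e = ⊥-elim (x≢l (sym e))
    ... | no _ with l ≟ y
    ... | yes e = ⊥-elim (y≢l (sym e))
    ... | no _ with l ≟ l
    ... | yes refl = refl
    ... | no l≢l = ⊥-elim (l≢l refl)

    fr : f r ≡ right
    fr with r ≟ x
    ... | yes e = ⊥-elim (x≢r (sym e))
    ... | no _ with r ≟ y
    ... | yes e = ⊥-elim (y≢r (sym e))
    ... | no _ with r ≟ l
    ... | yes e = ⊥-elim (l≢r (sym e))
    ... | no _ with r ≟ r
    ... | yes refl = refl
    ... | no r≢r = ⊥-elim (r≢r refl)

  no-star-cutset : ⊥
  no-star-cutset = no-labelled-star G x f fx (λ _ → spec) (λ _ → spec)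
    (λ u v eu ev → P≁Q u v (spec eu) (spec ev)) {y} fy {l} {r} fl fr

-- Homogeneous pairs

data Role2 : Set where
  hA hB : Role2

-- inn: the two sets of the pair; out: the rest, split by its relation to the pair as in weak fragments
data Place : Set where
  inn : Role2 → Place
  out : Role4 → Place

pairSign : Role2 → Role4 → Tri
pairSign hA wA = pos
pairSign hA wB = neg
pairSign hA wC = neg
pairSign hA wD = pos
pairSign hB wA = neg
pairSign hB wB = pos
pairSign hB wC = neg
pairSign hB wD = pos

-- What a weak fragment with C₁ and D₁ empty supplies: `big` is |A ∪ B| ≥ 4. The separate bounds on
-- |A| and |B| and the neighbours across the pair remain to be proved.
record IsPair (T : Trigraph n) (f : Fin n → Place) : Set where
  field
    rel      : ∀ {u v r o} → f u ≡ inn r → f v ≡ out o → θ T u v ≡ pairSign r o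
    nonempty : ∀ p → ∃ λ v → f v ≡ p
    big      : ∀ x y z → ∃ λ w → (∃ λ r → f w ≡ inn r) × w ≢ x × w ≢ y × w ≢ z

_≟Pl_ : (p q : Place) → Dec (p ≡ q)
inn hA ≟Pl inn hA = yes refl
inn hA ≟Pl inn hB = no λ ()
inn hB ≟Pl inn hA = no λ ()
inn hB ≟Pl inn hB = yes refl
inn _  ≟Pl out _  = no λ ()
out _  ≟Pl inn _  = no λ ()
out wA ≟Pl out wA = yes refl
out wA ≟Pl out wB = no λ ()
out wA ≟Pl out wC = no λ ()
out wA ≟Pl out wD = no λ ()
out wB ≟Pl out wA = no λ ()
out wB ≟Pl out wB = yes refl
out wB ≟Pl out wC = no λ ()
out wB ≟Pl out wD = no λ ()
out wC ≟Pl out wA = no λ ()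
out wC ≟Pl out wB = no λ ()
out wC ≟Pl out wC = yes refl
out wC ≟Pl out wD = no λ ()
out wD ≟Pl out wA = no λ ()
out wD ≟Pl out wB = no λ ()
out wD ≟Pl out wC = no λ ()
out wD ≟Pl out wD = yes refl

swapPl : Place → Place
swapPl (inn hA) = inn hB
swapPl (inn hB) = inn hA
swapPl (out wA) = out wB
swapPl (out wB) = out wA
swapPl (out wC) = out wC
swapPl (out wD) = out wD

swapPl-involutive : ∀ p → swapPl (swapPl p) ≡ p
swapPl-involutive (inn hA) = refl
swapPl-involutive (inn hB) = refl
swapPl-involutive (out wA) = refl
swapPl-involutive (out wB) = refl
swapPl-involutive (out wC) = refl
swapPl-involutive (out wD) = refl

-- A vertex complete to A and anticomplete to B has the opposite relations in the complement. So A₂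
-- and B₂ change places while A and B stay.
complPl : Place → Place
complPl (inn r)  = inn r
complPl (out wA) = out wB
complPl (out wB) = out wA
complPl (out wC) = out wD
complPl (out wD) = out wC

complPl-involutive : ∀ p → complPl (complPl p) ≡ p
complPl-involutive (inn r)  = refl
complPl-involutive (out wA) = refl
complPl-involutive (out wB) = refl
complPl-involutive (out wC) = refl
complPl-involutive (out wD) = refl

relabel : {p q : Place} (s : Place → Place) → (∀ p → s (s p) ≡ p) → s p ≡ q → p ≡ s q
relabel {p} s inv e = trans (sym (inv p)) (cong s e)

pair-swap : {T : Trigraph n} {f : Fin n → Place} → IsPair T f → IsPair T (swapPl ∘ f)
pair-swap {T = T} {f} H = record
  { rel = λ {u} {v} {r} {o} eu ev → rel′ r o (relabel swapPl swapPl-involutive eu) (relabel swapPl swapPl-involutive ev)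
  ; nonempty = λ p → let v , e = H.nonempty (swapPl p) in v , trans (cong swapPl e) (swapPl-involutive p)
  ; big = λ x y z → let w , r , ≢s = H.big x y z in w , inner r , ≢s
  }
  where
  module H = IsPair H
  rel′ : ∀ {u v} r o → f u ≡ swapPl (inn r) → f v ≡ swapPl (out o) → θ T u v ≡ pairSign r o
  rel′ hA wA = H.rel
  rel′ hA wB = H.rel
  rel′ hA wC = H.rel
  rel′ hA wD = H.rel
  rel′ hB wA = H.rel
  rel′ hB wB = H.rel
  rel′ hB wC = H.rel
  rel′ hB wD = H.rel
  inner : ∀ {w} → (∃ λ r → f w ≡ inn r) → ∃ λ r → swapPl (f w) ≡ inn r
  inner (hA , e) = hB , cong swapPl e
  inner (hB , e) = hA , cong swapPl e

pair-compl : {T : Trigraph n} {f : Fin n → Place} → IsPair T f → IsPair (compl T) (complPl ∘ f)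
pair-compl {T = T} {f} H = record
  { rel = λ {u} {v} {r} {o} eu ev → rel′ r o (relabel complPl complPl-involutive eu) (relabel complPl complPl-involutive ev)
  ; nonempty = λ p → let v , e = H.nonempty (complPl p) in v , trans (cong complPl e) (complPl-involutive p)
  ; big = λ x y z → let w , (r , e) , ≢s = H.big x y z in w , (r , cong complPl e) , ≢s
  }
  where
  module H = IsPair H
  rel′ : ∀ {u v} r o → f u ≡ inn r → f v ≡ complPl (out o) → negT (θ T u v) ≡ pairSign r o
  rel′ hA wA eu ev = cong negT (H.rel eu ev)
  rel′ hA wB eu ev = cong negT (H.rel eu ev)
  rel′ hA wC eu ev = cong negT (H.rel eu ev)
  rel′ hA wD eu ev = cong negT (H.rel eu ev)
  rel′ hB wA eu ev = cong negT (H.rel eu ev)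
  rel′ hB wB eu ev = cong negT (H.rel eu ev)
  rel′ hB wC eu ev = cong negT (H.rel eu ev)
  rel′ hB wD eu ev = cong negT (H.rel eu ev)

label≢ : {L : Set} {f : Fin n → L} {u v : Fin n} {p q : L} → f u ≡ p → f v ≡ q → p ≢ q → u ≢ v
label≢ eu ev p≢q refl = p≢q (trans (sym eu) ev)

-- For a vertex a of A without neighbours in B, the `Low` classes are those strongly anticomplete to
-- a, and the `High` classes those strongly complete to all of A.
data Low : Place → Set where
  lowB  : Low (inn hB)
  lowB₂ : Low (out wB)
  lowC₂ : Low (out wC)

data High : Place → Set where
  highA₂ : High (out wA)
  highD₂ : High (out wD)

low? : ∀ p → Dec (Low p)
low? (inn hA) = no λ ()
low? (inn hB) = yes lowB
low? (out wA) = no λ ()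
low? (out wB) = yes lowB₂
low? (out wC) = yes lowC₂
low? (out wD) = no λ ()

odd-3∨5≤ : Odd ℓ → 3 ≤ ℓ → ℓ ≡ 3 ⊎ 5 ≤ ℓ
odd-3∨5≤ (zero , refl) (s≤s ())
odd-3∨5≤ (suc zero , refl) _ = inj₁ refl
odd-3∨5≤ (suc (suc m) , refl) _ rewrite ℕₚ.+-suc m (suc (m + 0)) | ℕₚ.+-suc m (m + 0) = inj₂ (s≤s (s≤s (s≤s (s≤s (s≤s z≤n)))))

-- If a ∈ A has no neighbour in B, then {a} ∪ B ∪ B₂ ∪ C₂ against (A ∖ a) ∪ A₂ ∪ D₂ is a skew-partition;
-- a violating path or antipath is closed by a or by a vertex of A₂.
module _ {T : Trigraph n} (G : Tame T) {f : Fin n → Place} (H : IsPair T f)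
  {a : Fin n} (fa : f a ≡ inn hA) (a≁B : ∀ b → f b ≡ inn hB → StrAnti T a b) where
  private
    module G = Tame G
    module H = IsPair H

    A? : ∀ v → Dec (v ≡ a ⊎ Low (f v))
    A? v = (v ≟ a) ⊎-dec low? (f v)

    A : Subset n
    A = select A?

    Other : Fin n → Set
    Other v = f v ≡ inn hA × v ≢ a

    ∁A-view : ∀ {v} → v ∈ ∁ A → Other v ⊎ High (f v)
    ∁A-view {v} v∈ with f v | ∁-select⁻ A? {v} v∈
    ... | inn hA | h = inj₁ (refl , h ∘ inj₁)
    ... | inn hB | h = ⊥-elim (h (inj₂ lowB))
    ... | out wA | h = inj₂ highA₂
    ... | out wB | h = ⊥-elim (h (inj₂ lowB₂))
    ... | out wC | h = ⊥-elim (h (inj₂ lowC₂))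
    ... | out wD | h = inj₂ highD₂

    high-adj : ∀ {u v} → f u ≡ inn hA → High (f v) → StrAdj T u v
    high-adj {v = v} eu h with f v in ev
    high-adj eu highA₂ | .(out wA) = H.rel eu ev
    high-adj eu highD₂ | .(out wD) = H.rel eu ev

    low-anti : ∀ {v} → Low (f v) → StrAnti T a v
    low-anti {v} h with f v in ev
    low-anti lowB  | .(inn hB) = a≁B _ ev
    low-anti lowB₂ | .(out wB) = H.rel fa ev
    low-anti lowC₂ | .(out wC) = H.rel fa ev

    low-neighbour : ∀ {u v} → f u ≡ inn hA → Low (f v) → Adj T u v → f v ≡ inn hB
    low-neighbour {v = v} eu h u~v with f v in ev
    low-neighbour eu lowB  u~v | .(inn hB) = refl
    low-neighbour eu lowB₂ u~v | .(out wB) = ⊥-elim (neg-adj (H.rel eu ev) u~v)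
    low-neighbour eu lowC₂ u~v | .(out wC) = ⊥-elim (neg-adj (H.rel eu ev) u~v)

    a-isolated : ∀ {v} → v ∈ A → a ≢ v → StrAnti T a v
    a-isolated v∈ a≢v with ∈-select⁻ A? v∈
    ... | inj₁ e = ⊥-elim (a≢v (sym e))
    ... | inj₂ h = low-anti h

    low : ∀ {v w} → v ∈ A → w ∈ A → v ≢ w → Adj T v w → Low (f v)
    low v∈ w∈ v≢w v~w with ∈-select⁻ A? v∈
    ... | inj₁ refl = ⊥-elim (neg-adj (a-isolated w∈ v≢w) v~w)
    ... | inj₂ h = h

    low≢ : ∀ {v x p} → f x ≡ p → ¬ Low p → Low (f v) → x ≢ v
    low≢ e ¬h h refl = ¬h (subst Low e h)

    high≢a : ∀ {v} → High (f v) → a ≢ v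
    high≢a h refl with subst High fa h
    ... | ()

    x₂ : Fin n
    x₂ = proj₁ (H.nonempty (out wA))

    fx₂ : f x₂ ≡ out wA
    fx₂ = proj₂ (H.nonempty (out wA))

    no-path : ∀ {ℓ q} → IsPathℕ T ℓ q → Odd ℓ → 3 ≤ ℓ → q 0 ∈ ∁ A → q ℓ ∈ ∁ A →
              (∀ {i} → 0 < i → i < ℓ → q i ∈ A) → ⊥
    no-path {ℓ@(suc ℓ′)} {q} Q odd 3≤ℓ q₀ qₗ int = ends (∁A-view q₀) (∁A-view qₗ)
      where
      module Q = IsPathℕ Q
      2≤ℓ = ℕₚ.<⇒≤ 3≤ℓ
      ≁₀ₗ : Antiadj T (q 0) (q ℓ)
      ≁₀ₗ = Q.nonconsec 2≤ℓ ℕₚ.≤-refl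

      lowᵢ : ∀ {i} → 0 < i → i < ℓ → Low (f (q i))
      lowᵢ 0<i i<ℓ with interior-neighbour Q 3≤ℓ 0<i i<ℓ
      ... | j , 0<j , j<ℓ , ≢ᵢⱼ , ~ᵢⱼ = low (int 0<i i<ℓ) (int 0<j j<ℓ) ≢ᵢⱼ ~ᵢⱼ

      avoids : ∀ {x p} → f x ≡ p → ¬ Low p → x ≢ q 0 → x ≢ q ℓ → ∀ {i} → i ≤ ℓ → x ≢ q i
      avoids e ¬h x≢₀ x≢ₗ {zero} _ = x≢₀
      avoids e ¬h x≢₀ x≢ₗ {suc i} i<ℓ with ℕₚ.m≤n⇒m<n∨m≡n i<ℓ
      ... | inj₁ 1+i<ℓ = low≢ e ¬h (lowᵢ z<s 1+i<ℓ)
      ... | inj₂ refl  = x≢ₗ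

      inB : f (q 0) ≡ inn hA → f (q ℓ) ≡ inn hA → ∀ {i} → 0 < i → i < ℓ → f (q i) ≡ inn hB
      inB f₀ fₗ = interior-induction (λ i → f (q i) ≡ inn hB) f₁ next
        where
        f₁ : f (q 1) ≡ inn hB
        f₁ = low-neighbour f₀ (lowᵢ z<s 2≤ℓ) (Q.consec z<s)
        fₗ₋₁ : f (q ℓ′) ≡ inn hB
        fₗ₋₁ = low-neighbour fₗ (lowᵢ (ℕₚ.<⇒≤ (ℕₚ.≤-pred 3≤ℓ)) ℕₚ.≤-refl) (adj-sym T (Q.consec ℕₚ.≤-refl))
        -- a vertex of B₂ on the path would be strongly adjacent to both q 1 and q (ℓ - 1)
        notB₂ : ∀ {i} → 0 < i → suc i < ℓ → f (q (suc i)) ≡ out wB → ⊥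
        -- `q 2` follows `q 1`, so the conflict must come from `q (ℓ - 1)`: it is not consecutive to
        -- `q 2` when ℓ ≥ 5, and it is `q 2` itself, already known to lie in B, when ℓ = 3.
        notB₂ {suc zero} _ 2<ℓ e with odd-3∨5≤ odd 3≤ℓ
        ... | inj₁ refl = case trans (sym fₗ₋₁) e of λ ()
        ... | inj₂ 5≤ℓ = pos-anti (θ-flip T (H.rel fₗ₋₁ e)) (Q.nonconsec (ℕₚ.≤-pred 5≤ℓ) (ℕₚ.n≤1+n ℓ′))
        notB₂ {suc (suc i)} _ i<ℓ e =
          pos-anti (H.rel f₁ e) (Q.nonconsec (s≤s (s≤s (s≤s z≤n))) (ℕₚ.<⇒≤ i<ℓ))
        next : ∀ {i} → 0 < i → suc i < ℓ → f (q i) ≡ inn hB → f (q (suc i)) ≡ inn hB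
        next {i} 0<i i<ℓ fᵢ with f (q (suc i)) in e | lowᵢ {suc i} z<s i<ℓ
        ... | .(inn hB) | lowB  = refl
        ... | .(out wB) | lowB₂ = ⊥-elim (notB₂ 0<i i<ℓ e)
        ... | .(out wC) | lowC₂ = ⊥-elim (neg-adj (H.rel fᵢ e) (Q.consec (ℕₚ.<⇒≤ i<ℓ)))

      -- Ends of different kinds would be strongly adjacent. Two ends in A₂ ∪ D₂ are joined through
      -- `a`, two ends in A through `x₂`, which is strongly complete to A and strongly anticomplete
      -- to B.
      ends : Other (q 0) ⊎ High (f (q 0)) → Other (q ℓ) ⊎ High (f (q ℓ)) → ⊥
      ends (inj₁ (f₀ , _)) (inj₂ hₗ) = pos-anti (high-adj f₀ hₗ) ≁₀ₗ
      ends (inj₂ h₀) (inj₁ (fₗ , _)) = pos-anti (θ-flip T (high-adj fₗ h₀)) ≁₀ₗ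
      ends (inj₂ h₀) (inj₂ hₗ) = no-odd-closure G.no-odd-hole Q odd 2≤ℓ
        (inj₂ (high-adj fa h₀)) (inj₂ (high-adj fa hₗ)) (λ 0<i i<ℓ → inj₁ (low-anti (lowᵢ 0<i i<ℓ)))
        (avoids fa (λ ()) (high≢a h₀) (high≢a hₗ))
      ends (inj₁ (f₀ , _)) (inj₁ (fₗ , _)) = no-odd-closure G.no-odd-hole Q odd 2≤ℓ
        (inj₂ (θ-flip T (H.rel f₀ fx₂))) (inj₂ (θ-flip T (H.rel fₗ fx₂)))
        (λ 0<i i<ℓ → inj₁ (θ-flip T (H.rel (inB f₀ fₗ 0<i i<ℓ) fx₂)))
        (avoids fx₂ (λ ()) (label≢ {f = f} fx₂ f₀ (λ ())) (label≢ {f = f} fx₂ fₗ (λ ())))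

    no-antipath : ∀ {ℓ q} → IsPathℕ (compl T) ℓ q → Odd ℓ → 3 ≤ ℓ → q 0 ∈ A → q ℓ ∈ A →
              (∀ {i} → 0 < i → i < ℓ → q i ∈ ∁ A) → ⊥
    no-antipath {ℓ} {q} Q odd 3≤ℓ q₀ qₗ int = split (∁A-view (int z<s 2≤ℓ))
      where
      module Q = IsPathℕ Q
      2≤ℓ = ℕₚ.<⇒≤ 3≤ℓ
      ≢₀ₗ : q 0 ≢ q ℓ
      ≢₀ₗ = Q.distinct (ℕₚ.<-trans z<s 2≤ℓ) ℕₚ.≤-refl
      ~₀ₗ : Adj T (q 0) (q ℓ)
      ~₀ₗ = antiᶜ⇒adj (Q.nonconsec 2≤ℓ ℕₚ.≤-refl)
      low₀ : Low (f (q 0))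
      low₀ = low q₀ qₗ ≢₀ₗ ~₀ₗ
      lowₗ : Low (f (q ℓ))
      lowₗ = low qₗ q₀ (≢₀ₗ ∘ sym) (adj-sym T ~₀ₗ)

      avoids : ∀ {x p} → f x ≡ p → ¬ Low p → (∀ {i} → 0 < i → i < ℓ → x ≢ q i) → ∀ {i} → i ≤ ℓ → x ≢ q i
      avoids e ¬h x≢ {zero} _ = low≢ e ¬h low₀
      avoids e ¬h x≢ {suc i} i<ℓ with ℕₚ.m≤n⇒m<n∨m≡n i<ℓ
      ... | inj₁ 1+i<ℓ = x≢ z<s 1+i<ℓ
      ... | inj₂ refl  = low≢ e ¬h lowₗ

      -- A is strongly complete to A₂ ∪ D₂, whereas consecutive vertices of an antipath are
      -- antiadjacent; so the whole interior is on the side of `q 1`. This decides whether `a` or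
      -- `x₂` closes the antipath.
      split : Other (q 1) ⊎ High (f (q 1)) → ⊥
      split (inj₂ h₁) = no-odd-closure {T = compl T} G.no-odd-antihole Q odd 2≤ℓ
          (inj₂ (cong negT (low-anti low₀))) (inj₂ (cong negT (low-anti lowₗ)))
          (λ 0<i i<ℓ → inj₁ (cong negT (high-adj fa (high 0<i i<ℓ))))
          (avoids fa (λ ()) (λ 0<i i<ℓ → high≢a (high 0<i i<ℓ)))
        where
        high : ∀ {i} → 0 < i → i < ℓ → High (f (q i))
        high = interior-induction (λ i → High (f (q i))) h₁ next
          where
          next : ∀ {i} → 0 < i → suc i < ℓ → High (f (q i)) → High (f (q (suc i)))
          next 0<i i<ℓ h with ∁A-view (int z<s i<ℓ)
          ... | inj₂ h′ = h′
          ... | inj₁ (e , _) = ⊥-elim (pos-anti (θ-flip T (high-adj e h)) (adjᶜ⇒anti (Q.consec (ℕₚ.<⇒≤ i<ℓ))))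
      split (inj₁ o₁) = no-odd-closure {T = compl T} G.no-odd-antihole Q odd 2≤ℓ
          (inj₂ (cong negT (θ-flip T (H.rel f₀ fx₂)))) (inj₂ (cong negT (θ-flip T (H.rel fₗ fx₂))))
          (λ 0<i i<ℓ → inj₁ (cong negT (θ-flip T (H.rel (inA 0<i i<ℓ) fx₂))))
          (avoids fx₂ (λ ()) (λ 0<i i<ℓ → label≢ {f = f} fx₂ (inA 0<i i<ℓ) (λ ())))
        where
        inA : ∀ {i} → 0 < i → i < ℓ → f (q i) ≡ inn hA
        inA = interior-induction (λ i → f (q i) ≡ inn hA) (proj₁ o₁) next
          where
          next : ∀ {i} → 0 < i → suc i < ℓ → f (q i) ≡ inn hA → f (q (suc i)) ≡ inn hA
          next 0<i i<ℓ e with ∁A-view (int z<s i<ℓ)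
          ... | inj₁ (e′ , _) = e′
          ... | inj₂ h = ⊥-elim (pos-anti (high-adj e h) (adjᶜ⇒anti (Q.consec (ℕₚ.<⇒≤ i<ℓ))))
        -- Nonconsecutive vertices of an antipath are adjacent: `q 0` to `q 2`, and `q ℓ` to `q 1`.
        -- A `Low` neighbour of a vertex of A lies in B.
        f₀ : f (q 0) ≡ inn hB
        f₀ = low-neighbour (inA z<s 3≤ℓ) low₀ (adj-sym T (antiᶜ⇒adj (Q.nonconsec (s≤s (s≤s z≤n)) 2≤ℓ)))
        fₗ : f (q ℓ) ≡ inn hB
        fₗ = low-neighbour (proj₁ o₁) lowₗ (antiᶜ⇒adj (Q.nonconsec 3≤ℓ ℕₚ.≤-refl))

  no-isolated-pair-vertex : ∀ {a′} → f a′ ≡ inn hA → a′ ≢ a → ⊥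
  no-isolated-pair-vertex {a′} fa′ a′≢a = G.no-balanced (A ,
    ( separated⇒¬connected (_≡ a) stay (∈-select⁺ A? (inj₁ refl)) refl
        (∈-select⁺ A? (inj₂ (subst Low (sym fb) lowB))) (label≢ fb fa (λ ()))
    , separated⇒¬connected Other stay′
        (∁-select⁺ A? [ a′≢a , (λ h → case subst Low fa′ h of λ ()) ]′) (fa′ , a′≢a)
        (∁-select⁺ A? [ label≢ fx₂ fa (λ ()) , (λ h → case subst Low fx₂ h of λ ()) ]′)
        (λ (e , _) → case trans (sym e) fx₂ of λ ()) )
    , balancedℕ T A no-path no-antipath)
    where
    fb = proj₂ (H.nonempty (inn hB))
    stay : ∀ u v → u ∈ A → v ∈ A → u ≡ a → Adj T u v → v ≡ a
    stay u v _ v∈ refl u~v with v ≟ u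
    ... | yes e = e
    ... | no v≢u = ⊥-elim (neg-adj (a-isolated v∈ (v≢u ∘ sym)) u~v)
    stay′ : ∀ u v → u ∈ ∁ A → v ∈ ∁ A → Other u → Antiadj T u v → Other v
    stay′ u v _ v∈ (eu , _) u≁v with ∁A-view v∈
    ... | inj₁ o = o
    ... | inj₂ h = ⊥-elim (pos-anti (high-adj eu h) u≁v)

  -- B is a homogeneous set, and a vertex of it is the centre of a star cutset.
  no-isolated-singleton : (∀ v → f v ≡ inn hA → v ≡ a) → ⊥
  no-isolated-singleton only
    with H.nonempty (inn hB) | H.nonempty (out wB)
  ... | b , fb | y , fy with H.big a b b
  ...   | b′ , (hA , fb′) , b′≢a , _ = b′≢a (only b′ fb′)
  ...   | b′ , (hB , fb′) , _ , b′≢b , _ =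
    no-star-cutset G b y b′ a (λ v → f v ≡ inn hB) NonB
      (label≢ fb fy (λ ())) (b′≢b ∘ sym) (label≢ fb fa (λ ())) (label≢ fy fb′ (λ ())) (label≢ fy fa (λ ())) (label≢ fb′ fa (λ ()))
      (H.rel fb fy) fb′ (inj₁ fa) cover sep
    where
    NonB : Fin n → Set
    NonB v = f v ≡ inn hA ⊎ f v ≡ out wA ⊎ f v ≡ out wC
    cover : ∀ v → v ≢ b → StrAdj T b v ⊎ (f v ≡ inn hB ⊎ NonB v)
    cover v _ with f v in e
    ... | inn hA = inj₂ (inj₂ (inj₁ refl))
    ... | inn hB = inj₂ (inj₁ refl)
    ... | out wA = inj₂ (inj₂ (inj₂ (inj₁ refl)))
    ... | out wB = inj₁ (H.rel fb e)
    ... | out wC = inj₂ (inj₂ (inj₂ (inj₂ refl)))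
    ... | out wD = inj₁ (H.rel fb e)
    sep : ∀ u v → f u ≡ inn hB → NonB v → StrAnti T u v
    sep u v eu (inj₁ ev) rewrite only v ev = θ-flip T (a≁B u eu)
    sep u v eu (inj₂ (inj₁ ev)) = H.rel eu ev
    sep u v eu (inj₂ (inj₂ ev)) = H.rel eu ev

pair-neighbour : {T : Trigraph n} → Tame T → {f : Fin n → Place} → IsPair T f →
  ∀ a → f a ≡ inn hA → ∃ λ b → f b ≡ inn hB × Adj T a b
pair-neighbour {T = T} G {f} H a fa with any? (λ b → (f b ≟Pl inn hB) ×-dec adj? T a b)
... | yes found = found
... | no none with any? (λ v → (f v ≟Pl inn hA) ×-dec ¬? (v ≟ a))
...   | yes (a′ , fa′ , a′≢a) =
  ⊥-elim (no-isolated-pair-vertex G H fa (λ b fb → ¬adj⇒neg (λ a~b → none (b , fb , a~b))) fa′ a′≢a)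
...   | no single = ⊥-elim (no-isolated-singleton G H fa (λ b fb → ¬adj⇒neg (λ a~b → none (b , fb , a~b))) only)
  where
  only : ∀ v → f v ≡ inn hA → v ≡ a
  only v fv with v ≟ a
  ... | yes e = e
  ... | no v≢a = ⊥-elim (single (v , fv , v≢a))

-- An antineighbour in B is a neighbour in the complement, where A and B form a pair again.
pair-neighbours : {T : Trigraph n} → Tame T → {f : Fin n → Place} → IsPair T f → ∀ a → f a ≡ inn hA →
  (∃ λ b → f b ≡ inn hB × Adj T a b) × (∃ λ b → f b ≡ inn hB × Antiadj T a b)
pair-neighbours G H a fa = pair-neighbour G H a fa
  , (let b , fb , a≁b = pair-neighbour (tame-compl G) (pair-compl H) a (cong complPl fa)
     in b , relabel complPl complPl-involutive fb , adjᶜ⇒anti a≁b)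

module _ {T : Trigraph n} (G : Tame T) {f : Fin n → Place} (H : IsPair T f) where
  private module H = IsPair H

  pair-neighboursᴮ : ∀ b → f b ≡ inn hB →
    (∃ λ a → f a ≡ inn hA × Adj T b a) × (∃ λ a → f a ≡ inn hA × Antiadj T b a)
  pair-neighboursᴮ b fb with pair-neighbours G (pair-swap H) b (cong swapPl fb)
  ... | (a , fa , b~a) , (a′ , fa′ , b≁a′) =
    (a , relabel swapPl swapPl-involutive fa , b~a) , (a′ , relabel swapPl swapPl-involutive fa′ , b≁a′)

  -- If A = {a}, then a is switchable with every vertex of B.
  pair-two : ∃ λ a → ∃ λ a′ → f a ≡ inn hA × f a′ ≡ inn hA × a ≢ a′
  pair-two with H.nonempty (inn hA)
  ... | a , fa with any? (λ v → (f v ≟Pl inn hA) ×-dec ¬? (v ≟ a))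
  ...   | yes (a′ , fa′ , a′≢a) = a , a′ , fa , fa′ , a′≢a ∘ sym
  ...   | no single = ⊥-elim contra
    where
    only : ∀ v → f v ≡ inn hA → v ≡ a
    only v fv with v ≟ a
    ... | yes e = e
    ... | no v≢a = ⊥-elim (single (v , fv , v≢a))
    both : ∀ {t} → t ≡ zer ⊎ t ≡ pos → t ≡ neg ⊎ t ≡ zer → t ≡ zer
    both (inj₁ e) _ = e
    both (inj₂ refl) (inj₁ ())
    both (inj₂ refl) (inj₂ ())
    switch : ∀ b → f b ≡ inn hB → Switch T a b
    switch b fb with pair-neighboursᴮ b fb
    ... | (x , fx , b~x) , (x′ , fx′ , b≁x′) rewrite only x fx | only x′ fx′ = θ-flip T (both b~x b≁x′)
    another : ∀ y z → ∃ λ b → f b ≡ inn hB × b ≢ y × b ≢ z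
    another y z with H.big a y z
    ... | b , (hA , fb) , b≢a , _ = ⊥-elim (b≢a (only b fb))
    ... | b , (hB , fb) , _ , b≢y , b≢z = b , fb , b≢y , b≢z
    contra : ⊥
    -- As |A ∪ B| ≥ 4, three vertices of B are found, hence three switchable pairs at `a`.
    contra with another a a
    ... | b , fb , b≢a , _ with another b b
    ... | b′ , fb′ , b′≢b , _ with another b b′
    ... | b″ , fb″ , b″≢b , b″≢b′ = Tame.switch-degree≤2 G a b b′ b″
      (label≢ fb fa (λ ())) (label≢ fb′ fa (λ ())) (label≢ fb″ fa (λ ()))
      (b′≢b ∘ sym) (b″≢b ∘ sym) (b″≢b′ ∘ sym) (switch b fb) (switch b′ fb′) (switch b″ fb″)

pair⇒proper : {T : Trigraph n} → Tame T → {f : Fin n → Place} → IsPair T f →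
  ProperHomogeneousPair T (select (λ v → f v ≟Pl inn hA)) (select (λ v → f v ≟Pl inn hB))
pair⇒proper {n} {T} G {f} H = record
  { disjoint  = λ v a b → case trans (sym (mem a)) (mem b) of λ ()
  ; nonemptyA = map₂ mem⁺ (H.nonempty (inn hA))
  ; nonemptyB = map₂ mem⁺ (H.nonempty (inn hB))
  ; bigA      = let a , a′ , fa , fa′ , a≢a′ = pair-two G H in
                distinct⇒≤∣S∣ _ (a ∷ a′ ∷ []) ((a≢a′ ∷ []) ∷ [] ∷ []) (mem⁺ fa ∷ mem⁺ fa′ ∷ [])
  ; bigB      = let b , b′ , fb , fb′ , b≢b′ = pair-two G (pair-swap H) in
                distinct⇒≤∣S∣ _ (b ∷ b′ ∷ []) ((b≢b′ ∷ []) ∷ [] ∷ []) (mem⁺ (unswap fb) ∷ mem⁺ (unswap fb′) ∷ [])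
  ; coverA    = λ v ∉A ∉B → cover hA v ∉A ∉B
  ; coverB    = λ v ∉A ∉B → cover hB v ∉A ∉B
  ; nbAB      = λ a a∈ → let (b , fb , r) , (b′ , fb′ , r′) = pair-neighbours G H a (mem a∈) in
                (b , mem⁺ fb , r) , (b′ , mem⁺ fb′ , r′)
  ; nbBA      = λ b b∈ → let (a , fa , r) , (a′ , fa′ , r′) = pair-neighboursᴮ G H b (mem b∈) in
                (a , mem⁺ fa , r) , (a′ , mem⁺ fa′ , r′)
  ; a1b1      = let v , e = H.nonempty (out wD) in v , notin e , notin e , const e , const e
  ; a1b2      = let v , e = H.nonempty (out wA) in v , notin e , notin e , const e , const e
  ; a2b1      = let v , e = H.nonempty (out wB) in v , notin e , notin e , const e , const e
  ; a2b2      = let v , e = H.nonempty (out wC) in v , notin e , notin e , const e , const e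
  }
  where
  module H = IsPair H
  is? : ∀ p v → Dec (f v ≡ p)
  is? p v = f v ≟Pl p
  mem : ∀ {p v} → v ∈ select (is? p) → f v ≡ p
  mem {p} = ∈-select⁻ (is? p)
  mem⁺ : ∀ {p v} → f v ≡ p → v ∈ select (is? p)
  mem⁺ {p} = ∈-select⁺ (is? p)
  unswap : ∀ {v p} → swapPl (f v) ≡ p → f v ≡ swapPl p
  unswap = relabel swapPl swapPl-involutive
  notin : ∀ {v r o} → f v ≡ out o → v ∉ select (is? (inn r))
  notin e v∈ = case trans (sym (mem v∈)) e of λ ()
  const : ∀ {v r o} → f v ≡ out o → ∀ s → s ∈ select (is? (inn r)) → θ T v s ≡ pairSign r o
  const e s s∈ = θ-flip T (H.rel (mem s∈) e)
  sign-view : ∀ r o → pairSign r o ≡ pos ⊎ pairSign r o ≡ neg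
  sign-view hA wA = inj₁ refl
  sign-view hA wB = inj₂ refl
  sign-view hA wC = inj₂ refl
  sign-view hA wD = inj₁ refl
  sign-view hB wA = inj₂ refl
  sign-view hB wB = inj₁ refl
  sign-view hB wC = inj₂ refl
  sign-view hB wD = inj₁ refl
  cover : ∀ r v → v ∉ select (is? (inn hA)) → v ∉ select (is? (inn hB)) →
    SComplete T v (select (is? (inn r))) ⊎ SAnticomplete T v (select (is? (inn r)))
  cover r v ∉A ∉B with f v in e
  ... | inn hA = ⊥-elim (∉A (mem⁺ e))
  ... | inn hB = ⊥-elim (∉B (mem⁺ e))
  ... | out o with sign-view r o
  ...   | inj₁ p = inj₁ (λ s s∈ → trans (const e s s∈) p)
  ...   | inj₂ p = inj₂ (λ s s∈ → trans (const e s s∈) p)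

-- 2-joins

joinSign : Role3 → Role3 → Tri
joinSign rA rA = pos
joinSign rA rB = neg
joinSign rA rC = neg
joinSign rB rA = neg
joinSign rB rB = pos
joinSign rB rC = neg
joinSign rC _  = neg

-- The adjacency pattern alone, without sizes and properness. It is stable under exchanging the
-- sides and exchanging A with B (`join-flip`, `join-swap`), so one case of each symmetric statement
-- suffices.
record IsJoin (T : Trigraph n) (L : Fin n → Side × Role3) : Set where
  field
    rel       : ∀ {u v r r′} → L u ≡ (s1 , r) → L v ≡ (s2 , r′) → θ T u v ≡ joinSign r r′
    nonemptyA : ∀ s → ∃ λ v → L v ≡ (s , rA)
    nonemptyB : ∀ s → ∃ λ v → L v ≡ (s , rB)

_≟S_ : (s s′ : Side) → Dec (s ≡ s′)
s1 ≟S s1 = yes refl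
s1 ≟S s2 = no λ ()
s2 ≟S s1 = no λ ()
s2 ≟S s2 = yes refl

_≟R_ : (r r′ : Role3) → Dec (r ≡ r′)
rA ≟R rA = yes refl
rA ≟R rB = no λ ()
rA ≟R rC = no λ ()
rB ≟R rA = no λ ()
rB ≟R rB = yes refl
rB ≟R rC = no λ ()
rC ≟R rA = no λ ()
rC ≟R rB = no λ ()
rC ≟R rC = yes refl

_≟L_ : (p q : Side × Role3) → Dec (p ≡ q)
_≟L_ = ≡-dec _≟S_ _≟R_

other : Side → Side
other s1 = s2
other s2 = s1

flipL : Side × Role3 → Side × Role3
flipL (s , r) = other s , r

swapR : Role3 → Role3
swapR rA = rB
swapR rB = rA
swapR rC = rC

swapL : Side × Role3 → Side × Role3
swapL (s , r) = s , swapR r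

other-involutive : ∀ s → other (other s) ≡ s
other-involutive s1 = refl
other-involutive s2 = refl

swapR-involutive : ∀ r → swapR (swapR r) ≡ r
swapR-involutive rA = refl
swapR-involutive rB = refl
swapR-involutive rC = refl

unflip : ∀ {p : Side × Role3} {s r} → flipL p ≡ (s , r) → p ≡ (other s , r)
unflip {p} refl = cong (_, proj₂ p) (sym (other-involutive (proj₁ p)))

unswap : ∀ {p : Side × Role3} {s r} → swapL p ≡ (s , r) → p ≡ (s , swapR r)
unswap {p} refl = cong (proj₁ p ,_) (sym (swapR-involutive (proj₂ p)))

joinSign-sym : ∀ r r′ → joinSign r r′ ≡ joinSign r′ r
joinSign-sym rA rA = refl
joinSign-sym rA rB = refl
joinSign-sym rA rC = refl
joinSign-sym rB rA = refl
joinSign-sym rB rB = refl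
joinSign-sym rB rC = refl
joinSign-sym rC rA = refl
joinSign-sym rC rB = refl
joinSign-sym rC rC = refl

joinSign-swap : ∀ r r′ → joinSign (swapR r) (swapR r′) ≡ joinSign r r′
joinSign-swap rA rA = refl
joinSign-swap rA rB = refl
joinSign-swap rA rC = refl
joinSign-swap rB rA = refl
joinSign-swap rB rB = refl
joinSign-swap rB rC = refl
joinSign-swap rC rA = refl
joinSign-swap rC rB = refl
joinSign-swap rC rC = refl

joinSign-C : ∀ r → joinSign r rC ≡ neg
joinSign-C rA = refl
joinSign-C rB = refl
joinSign-C rC = refl

joinSign-notA : ∀ {r} → r ≢ rA → joinSign rA r ≡ neg
joinSign-notA {rA} h = ⊥-elim (h refl)
joinSign-notA {rB} _ = refl
joinSign-notA {rC} _ = refl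

joinSign-notB : ∀ {r} → r ≢ rB → joinSign rB r ≡ neg
joinSign-notB {rA} _ = refl
joinSign-notB {rB} h = ⊥-elim (h refl)
joinSign-notB {rC} _ = refl

join-flip : {T : Trigraph n} {L : Fin n → Side × Role3} → IsJoin T L → IsJoin T (flipL ∘ L)
join-flip {T = T} {L} J = record
  { rel = λ {u} {v} {r} {r′} eu ev →
      trans (θ-flip T (J.rel (unflip ev) (unflip eu))) (joinSign-sym r′ r)
  ; nonemptyA = λ s → let v , e = J.nonemptyA (other s) in v , trans (cong flipL e) (cong (_, rA) (other-involutive s))
  ; nonemptyB = λ s → let v , e = J.nonemptyB (other s) in v , trans (cong flipL e) (cong (_, rB) (other-involutive s))
  }
  where module J = IsJoin J

join-swap : {T : Trigraph n} {L : Fin n → Side × Role3} → IsJoin T L → IsJoin T (swapL ∘ L)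
join-swap {T = T} {L} J = record
  { rel = λ {u} {v} {r} {r′} eu ev → trans (J.rel (unswap eu) (unswap ev)) (joinSign-swap r r′)
  ; nonemptyA = λ s → map₂ (cong swapL) (J.nonemptyB s)
  ; nonemptyB = λ s → map₂ (cong swapL) (J.nonemptyA s)
  }
  where module J = IsJoin J

-- If C misses A₁, then C ∖ {x} is cut off by the star consisting of x ∈ B₁ and B₂,
-- unless B₁ = C is a single vertex, when X₁ ∖ C is cut off by a ∈ A₁ and A₂.
module _ {T : Trigraph n} (G : Tame T) {L : Fin n → Side × Role3} (J : IsJoin T L)
  (big : ∀ x y → ∃ λ w → proj₁ (L w) ≡ s1 × w ≢ x × w ≢ y)
  {C : Subset n} (C⊆ : ∀ {v} → v ∈ C → proj₁ (L v) ≡ s1) (inhabited : ∃ λ v → v ∈ C)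
  (closed : ∀ u v → u ∈ C → proj₁ (L v) ≡ s1 → Adj T u v → v ∈ C) where
  private
    module J = IsJoin J
    a₁ = proj₁ (J.nonemptyA s1)
    a₂ = proj₁ (J.nonemptyA s2)
    b₁ = proj₁ (J.nonemptyB s1)
    b₂ = proj₁ (J.nonemptyB s2)
    La₁ = proj₂ (J.nonemptyA s1)
    La₂ = proj₂ (J.nonemptyA s2)
    Lb₁ = proj₂ (J.nonemptyB s1)
    Lb₂ = proj₂ (J.nonemptyB s2)

    sealed : ∀ {u v} → u ∈ C → v ∉ C → proj₁ (L v) ≡ s1 → StrAnti T u v
    sealed u∈ v∉ e = ¬adj⇒neg (λ u~v → v∉ (closed _ _ u∈ e u~v))

    in₁ : ∀ {v r} → L v ≡ (s1 , r) → proj₁ (L v) ≡ s1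
    in₁ = cong proj₁

    out₂ : ∀ {v r} → L v ≡ (s2 , r) → v ∉ C
    out₂ e v∈ = case trans (sym (C⊆ v∈)) (cong proj₁ e) of λ ()

    module Missing (missA : ∀ {v} → v ∈ C → L v ≢ (s1 , rA)) where

      -- As `C` contains no vertex of A₁, its neighbours outside X₁ all lie in B₂, and inside X₁ it
      -- has none beyond itself. The vertex `a₁` remains on the other side.
      no-starB : ∀ x l → L x ≡ (s1 , rB) → l ∈ C → x ≢ l → ⊥
      no-starB x l Lx l∈ x≢l = no-star-cutset G x b₂ l a₁ (_∈ C) Q
        (label≢ Lx Lb₂ (λ ())) x≢l (label≢ Lx La₁ (λ ())) (λ { refl → out₂ Lb₂ l∈ }) (label≢ {f = L} Lb₂ La₁ (λ ()))
        (λ { refl → missA l∈ La₁ })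
        (J.rel Lx Lb₂) l∈ ((λ a∈ → missA a∈ La₁) , λ e → case trans (sym La₁) e of λ ()) cover sep
        where
        Q : Fin n → Set
        Q v = v ∉ C × L v ≢ (s2 , rB)
        cover : ∀ v → v ≢ x → StrAdj T x v ⊎ (v ∈ C ⊎ Q v)
        cover v _ with v ∈? C | L v ≟L (s2 , rB)
        ... | yes v∈ | _     = inj₂ (inj₁ v∈)
        ... | no _   | yes e = inj₁ (J.rel Lx e)
        ... | no v∉  | no ≢ᴮ = inj₂ (inj₂ (v∉ , ≢ᴮ))
        sep : ∀ u v → u ∈ C → Q v → StrAnti T u v
        sep u v u∈ (v∉ , v∉B₂) with L u in eu | L v in ev
        ... | s2 , _  | _       = ⊥-elim (out₂ eu u∈)
        ... | s1 , rA | _       = ⊥-elim (missA u∈ eu)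
        ... | s1 , _  | s1 , _  = sealed u∈ v∉ (in₁ ev)
        ... | s1 , rB | s2 , rA = J.rel eu ev
        ... | s1 , rB | s2 , rB = ⊥-elim (v∉B₂ refl)
        ... | s1 , rB | s2 , rC = J.rel eu ev
        ... | s1 , rC | s2 , _  = J.rel eu ev

      no-starA : b₁ ∈ C → (∀ v → L v ≡ (s1 , rB) → v ≡ b₁) → (∀ {v} → v ∈ C → v ≡ b₁) → ⊥
      -- `w` keeps X₁ nonempty after removal of `a₁` and `b₁`; the bound |X₁| ≥ 3 enters here.
      no-starA b₁∈ onlyB onlyC with big a₁ b₁
      ... | w , Lw , w≢a₁ , w≢b₁ = no-star-cutset G a₁ a₂ w b₁ P Q
        (label≢ {f = L} La₁ La₂ (λ ())) (w≢a₁ ∘ sym) (label≢ {f = L} La₁ Lb₁ (λ ()))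
        (label≢ (cong proj₁ La₂) Lw (λ ())) (label≢ {f = L} La₂ Lb₁ (λ ())) w≢b₁
        (J.rel La₁ La₂) (Lw , w≢b₁) (inj₁ refl) cover sep
        where
        P Q : Fin n → Set
        P v = proj₁ (L v) ≡ s1 × v ≢ b₁
        Q v = v ≡ b₁ ⊎ L v ≡ (s2 , rB) ⊎ L v ≡ (s2 , rC)
        cover : ∀ v → v ≢ a₁ → StrAdj T a₁ v ⊎ (P v ⊎ Q v)
        cover v _ with L v in e | v ≟ b₁
        ... | _       | yes refl = inj₂ (inj₂ (inj₁ refl))
        ... | s1 , _  | no v≢b₁  = inj₂ (inj₁ (refl , v≢b₁))
        ... | s2 , rA | no _     = inj₁ (J.rel La₁ e)
        ... | s2 , rB | no _     = inj₂ (inj₂ (inj₂ (inj₁ refl)))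
        ... | s2 , rC | no _     = inj₂ (inj₂ (inj₂ (inj₂ refl)))
        sep : ∀ u v → P u → Q v → StrAnti T u v
        sep u v (Lu , u≢b₁) (inj₁ refl) = θ-flip T (sealed b₁∈ (u≢b₁ ∘ onlyC) Lu)
        sep u v (Lu , u≢b₁) (inj₂ q) with L u in eu
        sep u v (refl , u≢b₁) (inj₂ _) | .s1 , rB = ⊥-elim (u≢b₁ (onlyB u eu))
        sep u v (refl , u≢b₁) (inj₂ (inj₁ e)) | .s1 , rA = J.rel eu e
        sep u v (refl , u≢b₁) (inj₂ (inj₁ e)) | .s1 , rC = J.rel eu e
        sep u v (refl , u≢b₁) (inj₂ (inj₂ e)) | .s1 , rA = J.rel eu e
        sep u v (refl , u≢b₁) (inj₂ (inj₂ e)) | .s1 , rC = J.rel eu e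

      contra : ⊥
      contra = no-starA (subst (_∈ C) (onlyC (proj₂ inhabited)) (proj₂ inhabited)) onlyB onlyC
        where
        onlyC : ∀ {v} → v ∈ C → v ≡ b₁
        onlyC {v} v∈ with v ≟ b₁
        ... | yes e = e
        ... | no v≢b₁ = ⊥-elim (no-starB b₁ v Lb₁ v∈ (v≢b₁ ∘ sym))
        onlyB : ∀ v → L v ≡ (s1 , rB) → v ≡ b₁
        onlyB v Lv with v ≟ b₁
        ... | yes e = e
        ... | no v≢b₁ = ⊥-elim (no-starB v b₁ Lv (subst (_∈ C) (onlyC (proj₂ inhabited)) (proj₂ inhabited)) v≢b₁)

  closed-meets-A : ∃ λ v → v ∈ C × L v ≡ (s1 , rA)
  closed-meets-A with any? (λ v → (v ∈? C) ×-dec (L v ≟L (s1 , rA)))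
  ... | yes found = found
  ... | no none = ⊥-elim (Missing.contra (λ {v} v∈ e → none (v , v∈ , e)))

-- Walks within one side of a 2-join

data Walk (T : Trigraph n) (L : Fin n → Side × Role3) (s : Side) : ℕ → Fin n → Set where
  start : ∀ {v} → L v ≡ (s , rB) → Walk T L s 0 v
  step  : ∀ {k u v} → Walk T L s k u → Adj T u v → proj₁ (L v) ≡ s → Walk T L s (suc k) v

module _ {T : Trigraph n} {L : Fin n → Side × Role3} {s : Side} where

  reach⇒walk : ∀ {C u v} → (∀ {w} → w ∈ C → proj₁ (L w) ≡ s) → L u ≡ (s , rB) → Reach (Adj T) C u v → ∃ λ k → Walk T L s k v
  reach⇒walk C⊆ Lu start = 0 , start Lu
  reach⇒walk C⊆ Lu (step p w∈ _ r) = let k , W = reach⇒walk C⊆ Lu p in suc k , step W r (C⊆ w∈)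

  -- the i-th vertex counted from the end of the walk
  at : ∀ {k v} → Walk T L s k v → ℕ → Fin n
  at {v = v} _            zero    = v
  at {v = v} (start _)    (suc i) = v
  at         (step W _ _) (suc i) = at W i

  -- A walk starts in B and grows at its end, from which `at` counts: `at W 0` is the end and
  -- `at W k` lies in B. A shortest path thus begins at its vertex of A₂, where further vertices are
  -- prepended.
  initial : ∀ {k v i} (W : Walk T L s k v) → i ≤ k → Walk T L s (k ∸ i) (at W i)
  initial {i = zero}  W            _         = W
  initial {i = suc i} (step W _ _) (s≤s i≤k) = initial W i≤k

  reroute : ∀ {k v i j} (W : Walk T L s k v) → i ≤ k → Walk T L s j (at W i) → Walk T L s (i + j) v
  reroute {i = zero}  W _ W′ = W′
  reroute {i = suc i} (step W r e) (s≤s i≤k) W′ = step (reroute W i≤k W′) r e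

  at-consec : ∀ {k v i} (W : Walk T L s k v) → i < k → Adj T (at W i) (at W (suc i))
  at-consec {i = zero}  (step (start _) r e)    _         = adj-sym T r
  at-consec {i = zero}  (step (step _ _ _) r e) _         = adj-sym T r
  at-consec {i = suc i} (step W r e)            (s≤s i<k) = at-consec W i<k

  walk-side : ∀ {k v} → Walk T L s k v → proj₁ (L v) ≡ s
  walk-side (start e)    = cong proj₁ e
  walk-side (step _ _ e) = e

  walk-start : ∀ {v} → Walk T L s 0 v → L v ≡ (s , rB)
  walk-start (start e) = e

odd∨odd-suc : ∀ k → Odd k ⊎ Odd (suc k)
odd∨odd-suc zero = inj₂ (0 , refl)
odd∨odd-suc (suc k) with odd∨odd-suc k
... | inj₁ o = inj₂ (odd-2+ o)
... | inj₂ o = inj₁ o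

-- What properness contributes to the size bound: one connected set of the side that contains a walk
-- from B to A.
record Linked (T : Trigraph n) (L : Fin n → Side × Role3) (s : Side) : Set where
  field
    {C}  : Subset n
    C⊆   : ∀ {v} → v ∈ C → proj₁ (L v) ≡ s
    conn : Connected T C
    A∩C  : ∃ λ v → v ∈ C × L v ≡ (s , rA)
    B∩C  : ∃ λ v → v ∈ C × L v ≡ (s , rB)

-- Sides with three vertices

module _ {T : Trigraph n} (G : Tame T) {L : Fin n → Side × Role3} (J : IsJoin T L)
  {a b m : Fin n} (La : L a ≡ (s1 , rA)) (Lb : L b ≡ (s1 , rB)) (m≢a : m ≢ a) (m≢b : m ≢ b)
  (only : ∀ v → proj₁ (L v) ≡ s1 → v ≡ a ⊎ v ≡ b ⊎ v ≡ m) where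
  private
    module G = Tame G
    module J = IsJoin J
    a₂ = proj₁ (J.nonemptyA s2)
    b₂ = proj₁ (J.nonemptyB s2)
    La₂ = proj₂ (J.nonemptyA s2)
    Lb₂ = proj₂ (J.nonemptyB s2)
    a≢b : a ≢ b
    a≢b = label≢ La Lb (λ ())

  module _ {r : Role3} (Lm : L m ≡ (s1 , r)) (r≢B : r ≢ rB) where
    private
      m≁ : ∀ {v} → L v ≡ (s2 , rB) ⊎ L v ≡ (s2 , rC) → StrAnti T m v
      m≁ (inj₁ e) = trans (J.rel Lm e) (trans (joinSign-sym r rB) (joinSign-notB r≢B))
      m≁ (inj₂ e) = trans (J.rel Lm e) (joinSign-C r)

    -- Otherwise the star of `a` and A₂ separates `m` from `b`, B₂ and C₂: as `m` is not in B₁, its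
    -- neighbours in X₂ lie in A₂.
    third-not-anti : ¬ StrAnti T m b
    third-not-anti m≁b = no-star-cutset G a a₂ m b (_≡ m) Q
      (label≢ La La₂ (λ ())) (m≢a ∘ sym) a≢b (label≢ La₂ Lm (λ ())) (label≢ La₂ Lb (λ ())) m≢b
      (J.rel La La₂) refl (inj₁ refl) cover sep
      where
      Q : Fin n → Set
      Q v = v ≡ b ⊎ (L v ≡ (s2 , rB) ⊎ L v ≡ (s2 , rC))
      cover : ∀ v → v ≢ a → StrAdj T a v ⊎ (v ≡ m ⊎ Q v)
      cover v v≢a with L v in e
      ... | s2 , rA = inj₁ (J.rel La e)
      ... | s2 , rB = inj₂ (inj₂ (inj₂ (inj₁ refl)))
      ... | s2 , rC = inj₂ (inj₂ (inj₂ (inj₂ refl)))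
      ... | s1 , _ with only v (cong proj₁ e)
      ...   | inj₁ v≡a        = ⊥-elim (v≢a v≡a)
      ...   | inj₂ (inj₁ v≡b) = inj₂ (inj₂ (inj₁ v≡b))
      ...   | inj₂ (inj₂ v≡m) = inj₂ (inj₁ v≡m)
      sep : ∀ u v → u ≡ m → Q v → StrAnti T u v
      sep u v refl (inj₁ refl) = m≁b
      sep u v refl (inj₂ q)    = m≁ q

    -- Otherwise `b` joins the star of `a` and A₂, which separates `m` from B₂ and C₂ whatever the
    -- pair `m b` is.
    ends-not-strong : ¬ StrAdj T a b
    ends-not-strong ab = no-star-cutset G a b m b₂ (_≡ m) (λ v → L v ≡ (s2 , rB) ⊎ L v ≡ (s2 , rC))
      a≢b (m≢a ∘ sym) (label≢ La Lb₂ (λ ())) (m≢b ∘ sym) (label≢ Lb Lb₂ (λ ())) (label≢ Lm Lb₂ (λ ()))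
      ab refl (inj₁ Lb₂) cover (λ { u v refl q → m≁ q })
      where
      cover : ∀ v → v ≢ a → StrAdj T a v ⊎ (v ≡ m ⊎ (L v ≡ (s2 , rB) ⊎ L v ≡ (s2 , rC)))
      cover v v≢a with L v in e
      ... | s2 , rA = inj₁ (J.rel La e)
      ... | s2 , rB = inj₂ (inj₂ (inj₁ refl))
      ... | s2 , rC = inj₂ (inj₂ (inj₂ refl))
      ... | s1 , _ with only v (cong proj₁ e)
      ...   | inj₁ v≡a         = ⊥-elim (v≢a v≡a)
      ...   | inj₂ (inj₁ refl) = inj₁ ab
      ...   | inj₂ (inj₂ v≡m)  = inj₂ (inj₁ v≡m)

  -- A shortest path of X₂ between A₂ and B₂ closes to a hole through the switchable edge ab,
  -- and, regarding ab as a non-edge, to a hole through a m b; their lengths differ by one.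
  no-switchable-triangle : L m ≡ (s1 , rC) → Adj T m a → Adj T m b → Switch T a b → Linked T L s2 → ⊥
  no-switchable-triangle Lm m~a m~b ab K = <-rec (λ k → ∀ v → L v ≡ (s2 , rA) → Walk T L s2 k v → ⊥) shortest
    (proj₁ walk) (proj₁ K.A∩C) (proj₂ (proj₂ K.A∩C)) (proj₂ walk)
    where
    module K = Linked K
    walk = reach⇒walk K.C⊆ (proj₂ (proj₂ K.B∩C))
      (K.conn (proj₁ K.B∩C) (proj₁ K.A∩C) (proj₁ (proj₂ K.B∩C)) (proj₁ (proj₂ K.A∩C)))

    shortest : ∀ k → (∀ {j} → j < k → ∀ v → L v ≡ (s2 , rA) → Walk T L s2 j v → ⊥) → ∀ v → L v ≡ (s2 , rA) → Walk T L s2 k v → ⊥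
    -- A walk of length 0 would consist of a vertex in both A₂ and B₂.
    shortest zero    _  v Lv W = case trans (sym Lv) (walk-start W) of λ ()
    shortest (suc k′) IH v Lv W = parity (odd∨odd-suc k)
      where
      k = suc k′
      q = at W

      -- A walk to an inner vertex that is too short reroutes `W` to a shorter one. A repeated
      -- vertex, a chord and an early vertex of B₂ all give such a walk; a further vertex of A₂
      -- gives a truncated walk, to which `IH` applies directly.
      minimal : ∀ {i j} → i ≤ k → Walk T L s2 j (q i) → i + j < k → ⊥
      minimal i≤k W′ lt = IH lt v Lv (reroute W i≤k W′)

      path : IsPathℕ T k q
      path = record
        { distinct  = λ {i} {j} i<j j≤k e → minimal (ℕₚ.≤-trans (ℕₚ.<⇒≤ i<j) j≤k)
            (subst (Walk T L s2 (k ∸ j)) (sym e) (initial W j≤k))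
            (ℕₚ.≤-trans (ℕₚ.+-monoˡ-≤ (k ∸ j) i<j) (ℕₚ.≤-reflexive (ℕₚ.m+[n∸m]≡n j≤k)))
        ; consec    = at-consec W
        ; nonconsec = λ {i} {j} i+1<j j≤k → inj₁ (¬adj⇒neg (λ i~j → minimal (i≤ i+1<j j≤k)
            (step (initial W j≤k) (adj-sym T i~j) (walk-side (initial W (i≤ i+1<j j≤k))))
            (ℕₚ.≤-trans (ℕₚ.≤-reflexive (cong suc (ℕₚ.+-suc i (k ∸ j))))
              (ℕₚ.≤-trans (ℕₚ.+-monoˡ-≤ (k ∸ j) i+1<j) (ℕₚ.≤-reflexive (ℕₚ.m+[n∸m]≡n j≤k))))))
        }
        where
        i≤ : ∀ {i j} → suc i < j → j ≤ k → i ≤ k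
        i≤ i+1<j j≤k = ℕₚ.≤-trans (ℕₚ.<⇒≤ (ℕₚ.<⇒≤ i+1<j)) j≤k

      role : ∀ {i} → i ≤ k → ∃ λ r → L (q i) ≡ (s2 , r)
      role {i} i≤k = proj₂ (L (q i)) , cong (_, proj₂ (L (q i))) (walk-side (initial W i≤k))

      a≁ : ∀ {i} → 0 < i → i ≤ k → StrAnti T a (q i)
      a≁ 0<i i≤k with role i≤k
      ... | r , e = trans (J.rel La e) (joinSign-notA (λ { refl →
        IH (ℕₚ.∸-monoʳ-< 0<i i≤k) _ e (initial W i≤k) }))

      b≁ : ∀ {i} → i < k → StrAnti T b (q i)
      b≁ {i} i<k with role (ℕₚ.<⇒≤ i<k)
      ... | r , e = trans (J.rel Lb e) (joinSign-notB (λ { refl →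
        minimal (ℕₚ.<⇒≤ i<k) (start e) (subst (_< k) (sym (ℕₚ.+-identityʳ i)) i<k) }))

      b~ : StrAdj T b (q k)
      b~ = J.rel Lb (walk-start (subst (λ j → Walk T L s2 j (q k)) (ℕₚ.n∸n≡0 k) (initial W ℕₚ.≤-refl)))

      apart : ∀ {x i} → proj₁ (L x) ≡ s1 → i ≤ k → x ≢ q i
      apart Lx i≤k = label≢ {f = L} (cong₂ _,_ Lx refl) (proj₂ (role i≤k)) (λ ())

      patha : IsPathℕ T (suc k) (a ◂ q)
      patha = extend-path path (inj₂ (J.rel La Lv)) (λ 0<i i≤k → inj₁ (a≁ 0<i i≤k)) (apart (cong proj₁ La))

      pathma : IsPathℕ T (2 + k) (m ◂ a ◂ q)
      pathma = extend-path patha m~a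
        (λ { {suc i} _ (s≤s i≤k) → inj₁ (J.rel Lm (proj₂ (role i≤k))) })
        (λ { {zero} _ → m≢a ; {suc i} (s≤s i≤k) → apart (cong proj₁ Lm) i≤k })

      b~a : Switch T b a
      b~a = θ-flip T ab

      -- The two holes have `k + 3` and `k + 4` vertices. A switchable pair is both adjacent and
      -- antiadjacent, so `b~a` is an edge of the first and a non-edge of the second.
      parity : Odd k ⊎ Odd (suc k) → ⊥
      parity (inj₂ odd) = no-odd-closure G.no-odd-hole patha odd (s≤s (s≤s z≤n))
        (inj₁ b~a) (inj₂ b~)
        (λ { {suc i} _ (s≤s i<k) → inj₁ (b≁ i<k) })
        (λ { {zero} _ → a≢b ∘ sym ; {suc i} (s≤s i≤k) → apart (cong proj₁ Lb) i≤k })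
      parity (inj₁ odd) = no-odd-closure G.no-odd-hole pathma (odd-2+ odd) (s≤s (s≤s z≤n))
        (adj-sym T m~b) (inj₂ b~)
        (λ { {suc zero} _ _ → inj₂ b~a ; {suc (suc i)} _ (s≤s (s≤s i<k)) → inj₁ (b≁ i<k) })
        (λ { {zero} _ → m≢b ∘ sym ; {suc zero} _ → a≢b ∘ sym ; {suc (suc i)} (s≤s (s≤s i≤k)) → apart (cong proj₁ Lb) i≤k })

module _ {T : Trigraph n} (G : Tame T) where

  -- The two star arguments, with `a` and `m` in either order, make both `b a` and `b m` switchable.
  -- Then `b` would be strongly complete or strongly anticomplete to all other vertices, but it is
  -- strongly antiadjacent to A₂ and strongly adjacent to B₂.
  no-triple-AAB : {L : Fin n → Side × Role3} → IsJoin T L → ∀ {a b m} → L a ≡ (s1 , rA) → L b ≡ (s1 , rB) → L m ≡ (s1 , rA) →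
    m ≢ a → (∀ v → proj₁ (L v) ≡ s1 → v ≡ a ⊎ v ≡ b ⊎ v ≡ m) → ⊥
  no-triple-AAB {L} J {a} {b} {m} La Lb Lm m≢a only =
    by-degree (Tame.switch-degree2 G b a m (m≢a ∘ sym) a≢b m≢b
      (switch (θ-sym T b a) (third-not-anti G J Lm Lb (m≢a ∘ sym) a≢b only′ La λ ()) (ends-not-strong G J La Lb m≢a m≢b only Lm λ ()))
      (switch (θ-sym T b m) (third-not-anti G J La Lb m≢a m≢b only Lm λ ()) (ends-not-strong G J Lm Lb (m≢a ∘ sym) a≢b only′ La λ ())))
    where
    module J = IsJoin J
    a≢b : a ≢ b
    a≢b = label≢ La Lb (λ ())
    m≢b : m ≢ b
    m≢b = label≢ Lm Lb (λ ())
    only′ : ∀ v → proj₁ (L v) ≡ s1 → v ≡ m ⊎ v ≡ b ⊎ v ≡ a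
    only′ v e with only v e
    ... | inj₁ v≡a        = inj₂ (inj₂ v≡a)
    ... | inj₂ (inj₁ v≡b) = inj₂ (inj₁ v≡b)
    ... | inj₂ (inj₂ v≡m) = inj₁ v≡m
    switch : ∀ {s t} → s ≡ t → t ≢ neg → t ≢ pos → s ≡ zer
    switch {neg} refl h _ = ⊥-elim (h refl)
    switch {zer} refl _ _ = refl
    switch {pos} refl _ h = ⊥-elim (h refl)
    by-degree : (∀ z → z ≢ b → z ≢ a → z ≢ m → StrAdj T b z) ⊎ (∀ z → z ≢ b → z ≢ a → z ≢ m → StrAnti T b z) → ⊥
    by-degree (inj₁ h) = let z , e = J.nonemptyA s2 in
      case trans (sym (h z (label≢ e Lb (λ ())) (label≢ e La (λ ())) (label≢ e Lm (λ ())))) (J.rel Lb e) of λ ()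
    by-degree (inj₂ h) = let z , e = J.nonemptyB s2 in
      case trans (sym (h z (label≢ e Lb (λ ())) (label≢ e La (λ ())) (label≢ e Lm (λ ())))) (J.rel Lb e) of λ ()

  module _ {L : Fin n → Side × Role3} (J : IsJoin T L) where
    private
      module J = IsJoin J

      swap-only : ∀ {a b m : Fin n} → (∀ v → proj₁ (L v) ≡ s1 → v ≡ a ⊎ v ≡ b ⊎ v ≡ m) →
                  ∀ v → proj₁ (L v) ≡ s1 → v ≡ b ⊎ v ≡ a ⊎ v ≡ m
      swap-only only v e with only v e
      ... | inj₁ v≡a        = inj₂ (inj₁ v≡a)
      ... | inj₂ (inj₁ v≡b) = inj₁ v≡b
      ... | inj₂ (inj₂ v≡m) = inj₂ (inj₂ v≡m)

    -- A third vertex in A₁ or B₁ is excluded by the degree condition. If it is in C₁, it is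
    -- adjacent to `a` and to `b`, and the three values of `a b` give a star cutset, the forbidden
    -- path of length two, and the switchable triangle.
    no-triple : Linked T L s2 → ∀ {a b m} → L a ≡ (s1 , rA) → L b ≡ (s1 , rB) → proj₁ (L m) ≡ s1 →
      m ≢ a → m ≢ b → (∀ v → proj₁ (L v) ≡ s1 → v ≡ a ⊎ v ≡ b ⊎ v ≡ m) →
      (L m ≡ (s1 , rC) → Adj T a m → Adj T m b → StrAnti T a b → ⊥) → ⊥
    no-triple K {a} {b} {m} La Lb Lm m≢a m≢b only notP2 with L m in e
    no-triple K La Lb refl m≢a m≢b only notP2 | s1 , rA = no-triple-AAB J La Lb e m≢a only
    no-triple K La Lb refl m≢a m≢b only notP2 | s1 , rB =
      no-triple-AAB (join-swap J) (cong swapL Lb) (cong swapL La) (cong swapL e) m≢b (swap-only only)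
    no-triple K {a} {b} {m} La Lb refl m≢a m≢b only notP2 | s1 , rC with θ T a b in ab
    ... | pos = ends-not-strong G J La Lb m≢a m≢b only e (λ ()) ab
    ... | neg = notP2 refl (adj-sym T m~a) m~b refl
      where
      m~b : Adj T m b
      m~b = ≢neg⇒adj (third-not-anti G J La Lb m≢a m≢b only e (λ ()))
      m~a : Adj T m a
      m~a = ≢neg⇒adj (third-not-anti G (join-swap J) (cong swapL Lb) (cong swapL La) m≢b m≢a (swap-only only) (cong swapL e) (λ ()))
    ... | zer = no-switchable-triangle G J La Lb m≢a m≢b only e m~a m~b ab K
      where
      m~b : Adj T m b
      m~b = ≢neg⇒adj (third-not-anti G J La Lb m≢a m≢b only e (λ ()))
      m~a : Adj T m a
      m~a = ≢neg⇒adj (third-not-anti G (join-swap J) (cong swapL Lb) (cong swapL La) m≢b m≢a (swap-only only) (cong swapL e) (λ ()))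

    join-size : Linked T L s2 → (S : Subset n) → (∀ v → (v ∈ S → proj₁ (L v) ≡ s1) × (proj₁ (L v) ≡ s1 → v ∈ S)) →
      3 ≤ ∣ S ∣ →
      (∀ {a b m} → L a ≡ (s1 , rA) → L b ≡ (s1 , rB) → L m ≡ (s1 , rC) → (∀ v → proj₁ (L v) ≡ s1 → v ≡ a ⊎ v ≡ b ⊎ v ≡ m) →
         Adj T a m → Adj T m b → StrAnti T a b → ⊥) →
      4 ≤ ∣ S ∣
    join-size K S S⇔ 3≤ notP2 with J.nonemptyA s1 | J.nonemptyB s1
    ... | a , La | b , Lb with fresh S (a ∷ b ∷ []) 3≤
    ... | m , m∈ , m≢a ∷ m≢b ∷ [] with any? (λ w → (w ∈? S) ×-dec (¬? (w ≟ a) ×-dec (¬? (w ≟ b) ×-dec ¬? (w ≟ m))))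
    ...   | yes (w , w∈ , w≢a , w≢b , w≢m) = distinct⇒≤∣S∣ S (w ∷ m ∷ a ∷ b ∷ [])
      ((w≢m ∷ w≢a ∷ w≢b ∷ []) ∷ (m≢a ∷ m≢b ∷ []) ∷ (label≢ La Lb (λ ()) ∷ []) ∷ [] ∷ [])
      (w∈ ∷ m∈ ∷ proj₂ (S⇔ a) (cong proj₁ La) ∷ proj₂ (S⇔ b) (cong proj₁ Lb) ∷ [])
    ...   | no none = ⊥-elim (no-triple K La Lb (proj₁ (S⇔ m) m∈) m≢a m≢b only (λ Lm → notP2 La Lb Lm only))
      where
      only : ∀ v → proj₁ (L v) ≡ s1 → v ≡ a ⊎ v ≡ b ⊎ v ≡ m
      only v e with v ≟ a | v ≟ b | v ≟ m
      ... | yes p | _ | _ = inj₁ p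
      ... | no _ | yes p | _ = inj₂ (inj₁ p)
      ... | no _ | no _ | yes p = inj₂ (inj₂ p)
      ... | no v≢a | no v≢b | no v≢m = ⊥-elim (none (v , proj₂ (S⇔ v) e , v≢a , v≢b , v≢m))

-- Fragments

2join⇒join : {T : Trigraph n} {X : Subset n} {L : Fin n → Side × Role3} → Is2Join T X L → IsJoin T L
2join⇒join {T = T} {L = L} D = record { rel = rel _ _ ; nonemptyA = D.nonemptyA ; nonemptyB = D.nonemptyB }
  where
  module D = Is2Join D
  rel : ∀ {u v} r r′ → L u ≡ (s1 , r) → L v ≡ (s2 , r′) → θ T u v ≡ joinSign r r′
  rel rA rA eu ev = D.compAA _ _ eu ev
  rel rA rB eu ev = D.anti _ _ _ _ eu ev (λ ()) (λ ())
  rel rA rC eu ev = D.anti _ _ _ _ eu ev (λ ()) (λ ())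
  rel rB rA eu ev = D.anti _ _ _ _ eu ev (λ ()) (λ ())
  rel rB rB eu ev = D.compBB _ _ eu ev
  rel rB rC eu ev = D.anti _ _ _ _ eu ev (λ ()) (λ ())
  rel rC rA eu ev = D.anti _ _ _ _ eu ev (λ ()) (λ ())
  rel rC rB eu ev = D.anti _ _ _ _ eu ev (λ ()) (λ ())
  rel rC rC eu ev = D.anti _ _ _ _ eu ev (λ ()) (λ ())

-- The adjacency conditions carry over with D₁ and D₂ empty; the content is the step from three to
-- four vertices on each side.
proper2join⇒weak : {T : Trigraph n} {X : Subset n} → Tame T → IsProper2Join T X → WeakFragment T X
proper2join⇒weak {n} {T} {X} G (L , D , proper) = embed ∘ L , record
  { sideX = D.sideX
  ; A-comp = λ { u v eu (inj₁ ev) → J.rel (unA eu) (unA ev) ; u v eu (inj₂ ev) → ⊥-elim (unD ev) }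
  ; A-anti = λ { u v eu (inj₁ ev) → J.rel (unA eu) (unB ev) ; u v eu (inj₂ ev) → J.rel (unA eu) (unC ev) }
  ; B-comp = λ { u v eu (inj₁ ev) → J.rel (unB eu) (unB ev) ; u v eu (inj₂ ev) → ⊥-elim (unD ev) }
  ; B-anti = λ { u v eu (inj₁ ev) → J.rel (unB eu) (unA ev) ; u v eu (inj₂ ev) → J.rel (unB eu) (unC ev) }
  ; C-anti = λ { u v eu (inj₁ ev) → J.rel (unC eu) (unA ev)
               ; u v eu (inj₂ (inj₁ ev)) → J.rel (unC eu) (unB ev)
               ; u v eu (inj₂ (inj₂ ev)) → J.rel (unC eu) (unC ev) }
  ; D-comp = λ u v eu _ → ⊥-elim (unD eu)
  ; size1 = join-size G J (linked s2) X D.sideX D.size1 notP2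
  ; size2 = join-size G (join-flip J) (linked-flip (linked s1)) (∁ X) ∁-side D.size2
      (λ La Lb Lm only → notP2 (unflip La) (unflip Lb) (unflip Lm) (λ v e → only v (cong other e)))
  ; nonemptyA = λ s → map₂ (cong embed) (D.nonemptyA s)
  ; nonemptyB = λ s → map₂ (cong embed) (D.nonemptyB s)
  ; cases = inj₂ (inj₁ ((λ _ → unD) , λ _ → unD))
  }
  where
  module D = Is2Join D
  J = 2join⇒join D
  module J = IsJoin J

  embed : Side × Role3 → Side × Role4
  embed p = proj₁ p , embedR (proj₂ p)
    where
    embedR : Role3 → Role4
    embedR rA = wA
    embedR rB = wB
    embedR rC = wC

  unA : ∀ {p s} → embed p ≡ (s , wA) → p ≡ (s , rA)
  unA {_ , rA} refl = refl
  unA {_ , rB} ()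
  unA {_ , rC} ()
  unB : ∀ {p s} → embed p ≡ (s , wB) → p ≡ (s , rB)
  unB {_ , rB} refl = refl
  unB {_ , rA} ()
  unB {_ , rC} ()
  unC : ∀ {p s} → embed p ≡ (s , wC) → p ≡ (s , rC)
  unC {_ , rC} refl = refl
  unC {_ , rA} ()
  unC {_ , rB} ()
  unD : ∀ {p s} → embed p ≢ (s , wD)
  unD {_ , rA} ()
  unD {_ , rB} ()
  unD {_ , rC} ()

  side? : ∀ s v → Dec (proj₁ (L v) ≡ s)
  side? s v = proj₁ (L v) ≟S s

  -- The component of a vertex of A in its side meets B by properness.
  linked : ∀ s → Linked T L s
  linked s with D.nonemptyA s
  ... | a , La with Components.component (Adj T) (adj-sym T) (adj? T) (select (side? s)) (∈-select⁺ (side? s) (cong proj₁ La))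
  ... | C , a∈C , isC@(C⊆ , _ , conn , _) = record
    { C⊆ = ∈-select⁻ (side? s) ∘ C⊆ ; conn = conn ; A∩C = a , a∈C , La
    ; B∩C = proj₂ (proper s (select (side? s)) C (λ v → ∈-select⁻ (side? s) , ∈-select⁺ (side? s)) isC) }

  linked-flip : Linked T L s1 → Linked T (flipL ∘ L) s2
  linked-flip K = record
    { C⊆ = cong other ∘ K.C⊆ ; conn = K.conn
    ; A∩C = map₂ (map₂ (cong flipL)) K.A∩C ; B∩C = map₂ (map₂ (cong flipL)) K.B∩C }
    where module K = Linked K

  ∁-side : ∀ v → (v ∈ ∁ X → proj₁ (flipL (L v)) ≡ s1) × (proj₁ (flipL (L v)) ≡ s1 → v ∈ ∁ X)
  ∁-side v = to , λ e → x∉p⇒x∈∁p (λ v∈ → case trans (sym (cong other (proj₁ (D.sideX v) v∈))) e of λ ())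
    where
    to : v ∈ ∁ X → other (proj₁ (L v)) ≡ s1
    to v∈ with proj₁ (L v) | D.sideX v
    ... | s1 | _ , from = ⊥-elim (x∈∁p⇒x∉p v∈ (from refl))
    ... | s2 | _ = refl

  notP2 : ∀ {s a b m} → L a ≡ (s , rA) → L b ≡ (s , rB) → L m ≡ (s , rC) →
    (∀ v → proj₁ (L v) ≡ s → v ≡ a ⊎ v ≡ b ⊎ v ≡ m) → Adj T a m → Adj T m b → StrAnti T a b → ⊥
  notP2 {s} {a} {b} {m} La Lb Lm only = D.notP2 s a b m uniqueA La uniqueB Lb (cong proj₁ Lm)
    (label≢ Lm La (λ ())) (label≢ Lm Lb (λ ())) only
    where
    uniqueA : ∀ v → L v ≡ (s , rA) → v ≡ a
    uniqueA v e with only v (cong proj₁ e)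
    ... | inj₁ v≡a         = v≡a
    ... | inj₂ (inj₁ refl) = case trans (sym e) Lb of λ ()
    ... | inj₂ (inj₂ refl) = case trans (sym e) Lm of λ ()
    uniqueB : ∀ v → L v ≡ (s , rB) → v ≡ b
    uniqueB v e with only v (cong proj₁ e)
    ... | inj₁ refl        = case trans (sym e) La of λ ()
    ... | inj₂ (inj₁ v≡b)  = v≡b
    ... | inj₂ (inj₂ refl) = case trans (sym e) Lm of λ ()

-- Two vertices from each of A and B, and one from each of the four outer classes, account for the
-- bounds of four.
pair⇒weak : {T : Trigraph n} {X A B : Subset n} → ProperHomogeneousPair T A B →
  (∀ v → (v ∈ X → v ∈ A ⊎ v ∈ B) × (v ∈ A ⊎ v ∈ B → v ∈ X)) → WeakFragment T X
pair⇒weak {n} {T} {X} {A} {B} H X⇔ = L , record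
  { sideX = λ v → (λ v∈ → side₁ (proj₁ (X⇔ v) v∈)) , λ e → proj₂ (X⇔ v) (in₁ e)
  ; A-comp = λ { u v eu (inj₁ ev) → θ-flip T (fst (spec v ev) u (spec u eu)) ; u v eu (inj₂ ev) → θ-flip T (fst (spec v ev) u (spec u eu)) }
  ; A-anti = λ { u v eu (inj₁ ev) → θ-flip T (fst (spec v ev) u (spec u eu)) ; u v eu (inj₂ ev) → θ-flip T (fst (spec v ev) u (spec u eu)) }
  ; B-comp = λ { u v eu (inj₁ ev) → θ-flip T (snd (spec v ev) u (spec u eu)) ; u v eu (inj₂ ev) → θ-flip T (snd (spec v ev) u (spec u eu)) }
  ; B-anti = λ { u v eu (inj₁ ev) → θ-flip T (snd (spec v ev) u (spec u eu)) ; u v eu (inj₂ ev) → θ-flip T (snd (spec v ev) u (spec u eu)) }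
  ; C-anti = λ u v eu _ → ⊥-elim (spec u eu)
  ; D-comp = λ u v eu _ → ⊥-elim (spec u eu)
  ; size1 = size₁
  ; size2 = distinct⇒≤∣S∣ (∁ X) (proj₁ oA ∷ proj₁ oB ∷ proj₁ oC ∷ proj₁ oD ∷ [])
      ((apart oA oB (λ ()) ∷ apart oA oC (λ ()) ∷ apart oA oD (λ ()) ∷ []) ∷
       (apart oB oC (λ ()) ∷ apart oB oD (λ ()) ∷ []) ∷ (apart oC oD (λ ()) ∷ []) ∷ [] ∷ [])
      (∉X oA ∷ ∉X oB ∷ ∉X oC ∷ ∉X oD ∷ [])
  ; nonemptyA = λ { s1 → map₂ inA⇒ H.nonemptyA ; s2 → oA }
  ; nonemptyB = λ { s1 → map₂ inB⇒ H.nonemptyB ; s2 → oB }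
  ; cases = inj₁ ((λ v → spec v) , (λ v → spec v) , oC , oD)
  }
  where
  module H = ProperHomogeneousPair H

  Outer : (Fin n → Subset n → Set) → (Fin n → Subset n → Set) → Fin n → Set
  Outer R S v = (v ∉ A × v ∉ B) × R v A × S v B

  Spec : Side × Role4 → Fin n → Set
  Spec (s1 , wA) v = v ∈ A
  Spec (s1 , wB) v = v ∈ B
  Spec (s1 , _)  v = ⊥
  Spec (s2 , wA) = Outer (SComplete T) (SAnticomplete T)
  Spec (s2 , wB) = Outer (SAnticomplete T) (SComplete T)
  Spec (s2 , wC) = Outer (SAnticomplete T) (SAnticomplete T)
  Spec (s2 , wD) = Outer (SComplete T) (SComplete T)

  classify : ∀ v → ∃ λ p → Spec p v
  classify v with v ∈? A | v ∈? B
  ... | yes v∈ | _ = (s1 , wA) , v∈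
  ... | no _ | yes v∈ = (s1 , wB) , v∈
  ... | no ∉A | no ∉B with H.coverA v ∉A ∉B | H.coverB v ∉A ∉B
  ... | inj₁ c | inj₁ d = (s2 , wD) , (∉A , ∉B) , c , d
  ... | inj₁ c | inj₂ d = (s2 , wA) , (∉A , ∉B) , c , d
  ... | inj₂ c | inj₁ d = (s2 , wB) , (∉A , ∉B) , c , d
  ... | inj₂ c | inj₂ d = (s2 , wC) , (∉A , ∉B) , c , d

  L : Fin n → Side × Role4
  L v = proj₁ (classify v)

  spec : ∀ v {p} → L v ≡ p → Spec p v
  spec v e = subst (λ p → Spec p v) e (proj₂ (classify v))

  fst : {P Q R : Set} → P × Q × R → Q
  fst (_ , c , _) = c
  snd : {P Q R : Set} → P × Q × R → R
  snd (_ , _ , d) = d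

  inA⇒ : ∀ {v} → v ∈ A → L v ≡ (s1 , wA)
  inA⇒ {v} v∈ with v ∈? A
  ... | yes _ = refl
  ... | no v∉ = ⊥-elim (v∉ v∈)

  inB⇒ : ∀ {v} → v ∈ B → L v ≡ (s1 , wB)
  inB⇒ {v} v∈ with v ∈? A | v ∈? B
  ... | yes v∈A | _ = ⊥-elim (H.disjoint v v∈A v∈)
  ... | no _ | yes _ = refl
  ... | no _ | no v∉ = ⊥-elim (v∉ v∈)

  side₁ : ∀ {v} → v ∈ A ⊎ v ∈ B → proj₁ (L v) ≡ s1
  side₁ (inj₁ v∈) = cong proj₁ (inA⇒ v∈)
  side₁ (inj₂ v∈) = cong proj₁ (inB⇒ v∈)

  in₁ : ∀ {v} → proj₁ (L v) ≡ s1 → v ∈ A ⊎ v ∈ B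
  in₁ {v} e with L v in e′
  in₁ {v} refl | .s1 , wA = inj₁ (spec v e′)
  in₁ {v} refl | .s1 , wB = inj₂ (spec v e′)
  in₁ {v} refl | .s1 , wC = ⊥-elim (spec v e′)
  in₁ {v} refl | .s1 , wD = ⊥-elim (spec v e′)

  -- `classify` takes whatever alternative `coverA` and `coverB` return. As A and B are nonempty, no
  -- vertex satisfies both alternatives, so the witnesses of the four outer classes receive the
  -- expected labels.
  clashA : ∀ {v} → SComplete T v A → SAnticomplete T v A → ⊥
  clashA c d = let a , a∈ = H.nonemptyA in case trans (sym (c a a∈)) (d a a∈) of λ ()
  clashB : ∀ {v} → SComplete T v B → SAnticomplete T v B → ⊥
  clashB c d = let b , b∈ = H.nonemptyB in case trans (sym (c b b∈)) (d b b∈) of λ ()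

  oA : NonEmpty4 L s2 wA
  oA with H.a1b2
  ... | v , ∉A , ∉B , c , d with L v in e
  ... | s1 , _  = ⊥-elim ([ ∉A , ∉B ]′ (in₁ (cong proj₁ e)))
  ... | s2 , wA = v , e
  ... | s2 , wB = ⊥-elim (clashA c (fst (spec v e)))
  ... | s2 , wC = ⊥-elim (clashA c (fst (spec v e)))
  ... | s2 , wD = ⊥-elim (clashB (snd (spec v e)) d)

  oB : NonEmpty4 L s2 wB
  oB with H.a2b1
  ... | v , ∉A , ∉B , c , d with L v in e
  ... | s1 , _  = ⊥-elim ([ ∉A , ∉B ]′ (in₁ (cong proj₁ e)))
  ... | s2 , wA = ⊥-elim (clashA (fst (spec v e)) c)
  ... | s2 , wB = v , e
  ... | s2 , wC = ⊥-elim (clashB d (snd (spec v e)))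
  ... | s2 , wD = ⊥-elim (clashA (fst (spec v e)) c)

  oC : NonEmpty4 L s2 wC
  oC with H.a2b2
  ... | v , ∉A , ∉B , c , d with L v in e
  ... | s1 , _  = ⊥-elim ([ ∉A , ∉B ]′ (in₁ (cong proj₁ e)))
  ... | s2 , wA = ⊥-elim (clashA (fst (spec v e)) c)
  ... | s2 , wB = ⊥-elim (clashB (snd (spec v e)) d)
  ... | s2 , wC = v , e
  ... | s2 , wD = ⊥-elim (clashA (fst (spec v e)) c)

  oD : NonEmpty4 L s2 wD
  oD with H.a1b1
  ... | v , ∉A , ∉B , c , d with L v in e
  ... | s1 , _  = ⊥-elim ([ ∉A , ∉B ]′ (in₁ (cong proj₁ e)))
  ... | s2 , wA = ⊥-elim (clashB d (snd (spec v e)))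
  ... | s2 , wB = ⊥-elim (clashA c (fst (spec v e)))
  ... | s2 , wC = ⊥-elim (clashA c (fst (spec v e)))
  ... | s2 , wD = v , e

  apart : ∀ {r r′} (p : NonEmpty4 L s2 r) (q : NonEmpty4 L s2 r′) → r ≢ r′ → proj₁ p ≢ proj₁ q
  apart (_ , e) (_ , e′) r≢r′ = label≢ {f = L} e e′ (r≢r′ ∘ cong proj₂)

  ∉X : ∀ {r} (p : NonEmpty4 L s2 r) → proj₁ p ∈ ∁ X
  ∉X (v , e) = x∉p⇒x∈∁p (λ v∈ → case trans (sym (side₁ (proj₁ (X⇔ v) v∈))) (cong proj₁ e) of λ ())

  size₁ : 4 ≤ ∣ X ∣
  size₁ with H.nonemptyA | H.nonemptyB
  ... | a , a∈ | b , b∈ with fresh A (a ∷ []) H.bigA | fresh B (b ∷ []) H.bigB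
  ... | a′ , a′∈ , a′≢a ∷ [] | b′ , b′∈ , b′≢b ∷ [] = distinct⇒≤∣S∣ X (a ∷ a′ ∷ b ∷ b′ ∷ [])
    ((a′≢a ∘ sym ∷ A≢B a∈ b∈ ∷ A≢B a∈ b′∈ ∷ []) ∷ (A≢B a′∈ b∈ ∷ A≢B a′∈ b′∈ ∷ []) ∷ (b′≢b ∘ sym ∷ []) ∷ [] ∷ [])
    (∈X (inj₁ a∈) ∷ ∈X (inj₁ a′∈) ∷ ∈X (inj₂ b∈) ∷ ∈X (inj₂ b′∈) ∷ [])
    where
    ∈X : ∀ {v} → v ∈ A ⊎ v ∈ B → v ∈ X
    ∈X = proj₂ (X⇔ _)
    A≢B : ∀ {u v} → u ∈ A → v ∈ B → u ≢ v
    A≢B u∈ v∈ refl = H.disjoint _ u∈ v∈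

-- Complementation exchanges C and D, and A₂ and B₂.
complL : Side × Role4 → Side × Role4
complL (s1 , wA) = s1 , wA
complL (s1 , wB) = s1 , wB
complL (s2 , wA) = s2 , wB
complL (s2 , wB) = s2 , wA
complL (s , wC)  = s , wD
complL (s , wD)  = s , wC

complL-involutive : ∀ p → complL (complL p) ≡ p
complL-involutive (s1 , wA) = refl
complL-involutive (s1 , wB) = refl
complL-involutive (s1 , wC) = refl
complL-involutive (s1 , wD) = refl
complL-involutive (s2 , wA) = refl
complL-involutive (s2 , wB) = refl
complL-involutive (s2 , wC) = refl
complL-involutive (s2 , wD) = refl

-- The complement enters through a pointwise equation, so the lemma leads from `T` to `compl T` and
-- also back, where `compl (compl T)` would not reduce to `T`.
weak-compl : {T T′ : Trigraph n} {X : Subset n} {L : Fin n → Side × Role4} →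
  (∀ u v → θ T′ u v ≡ negT (θ T u v)) → IsWeakFragmentBy T X L → IsWeakFragmentBy T′ X (complL ∘ L)
weak-compl {n} {T} {T′} {X} {L} neg-θ W = record
  { sideX = λ v → (λ v∈ → trans (same (L v)) (proj₁ (W.sideX v) v∈)) , λ e → proj₂ (W.sideX v) (trans (sym (same (L v))) e)
  ; A-comp = λ { u v eu (inj₁ ev) → neg⇒ (W.A-anti u v (back eu) (inj₁ (back ev)))
               ; u v eu (inj₂ ev) → neg⇒ (W.A-anti u v (back eu) (inj₂ (back ev))) }
  ; A-anti = λ { u v eu (inj₁ ev) → neg⇒ (W.A-comp u v (back eu) (inj₁ (back ev)))
               ; u v eu (inj₂ ev) → neg⇒ (W.A-comp u v (back eu) (inj₂ (back ev))) }
  ; B-comp = λ { u v eu (inj₁ ev) → neg⇒ (W.B-anti u v (back eu) (inj₁ (back ev)))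
               ; u v eu (inj₂ ev) → neg⇒ (W.B-anti u v (back eu) (inj₂ (back ev))) }
  ; B-anti = λ { u v eu (inj₁ ev) → neg⇒ (W.B-comp u v (back eu) (inj₁ (back ev)))
               ; u v eu (inj₂ ev) → neg⇒ (W.B-comp u v (back eu) (inj₂ (back ev))) }
  ; C-anti = λ { u v eu (inj₁ ev) → neg⇒ (W.D-comp u v (back eu) (inj₂ (inj₁ (back ev))))
               ; u v eu (inj₂ (inj₁ ev)) → neg⇒ (W.D-comp u v (back eu) (inj₁ (back ev)))
               ; u v eu (inj₂ (inj₂ ev)) → neg⇒ (W.D-comp u v (back eu) (inj₂ (inj₂ (back ev)))) }
  ; D-comp = λ { u v eu (inj₁ ev) → neg⇒ (W.C-anti u v (back eu) (inj₂ (inj₁ (back ev))))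
               ; u v eu (inj₂ (inj₁ ev)) → neg⇒ (W.C-anti u v (back eu) (inj₁ (back ev)))
               ; u v eu (inj₂ (inj₂ ev)) → neg⇒ (W.C-anti u v (back eu) (inj₂ (inj₂ (back ev)))) }
  ; size1 = W.size1
  ; size2 = W.size2
  ; nonemptyA = λ { s1 → map₂ (cong complL) (W.nonemptyA s1) ; s2 → map₂ (cong complL) (W.nonemptyB s2) }
  ; nonemptyB = λ { s1 → map₂ (cong complL) (W.nonemptyB s1) ; s2 → map₂ (cong complL) (W.nonemptyA s2) }
  ; cases = cases W.cases
  }
  where
  module W = IsWeakFragmentBy W
  same : ∀ p → proj₁ (complL p) ≡ proj₁ p
  same (s1 , wA) = refl
  same (s1 , wB) = refl
  same (s1 , wC) = refl
  same (s1 , wD) = refl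
  same (s2 , wA) = refl
  same (s2 , wB) = refl
  same (s2 , wC) = refl
  same (s2 , wD) = refl
  back : ∀ {v q} → complL (L v) ≡ q → L v ≡ complL q
  back {v} e = trans (sym (complL-involutive (L v))) (cong complL e)
  neg⇒ : ∀ {u v t} → θ T u v ≡ t → θ T′ u v ≡ negT t
  neg⇒ e = trans (neg-θ _ _) (cong negT e)
  cases : (Empty4 L s1 wC × Empty4 L s1 wD × NonEmpty4 L s2 wC × NonEmpty4 L s2 wD) ⊎ (Empty4 L s1 wD × Empty4 L s2 wD) ⊎ (Empty4 L s1 wC × Empty4 L s2 wC) →
          let L′ = complL ∘ L in
          (Empty4 L′ s1 wC × Empty4 L′ s1 wD × NonEmpty4 L′ s2 wC × NonEmpty4 L′ s2 wD) ⊎ (Empty4 L′ s1 wD × Empty4 L′ s2 wD) ⊎ (Empty4 L′ s1 wC × Empty4 L′ s2 wC)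
  cases (inj₁ (eC , eD , nC , nD)) = inj₁ ((λ v → eD v ∘ back) , (λ v → eC v ∘ back) , map₂ (cong complL) nD , map₂ (cong complL) nC)
  cases (inj₂ (inj₁ (e , e′))) = inj₂ (inj₂ ((λ v → e v ∘ back) , (λ v → e′ v ∘ back)))
  cases (inj₂ (inj₂ (e , e′))) = inj₂ (inj₁ ((λ v → e v ∘ back) , (λ v → e′ v ∘ back)))

-- From weak to proper fragments

module _ {T : Trigraph n} (G : Tame T) {X : Subset n} {L : Fin n → Side × Role4} (W : IsWeakFragmentBy T X L) where
  private
    module W = IsWeakFragmentBy W

    fresh₁ : ∀ x y z → ∃ λ w → proj₁ (L w) ≡ s1 × w ≢ x × w ≢ y × w ≢ z
    fresh₁ x y z with fresh X (x ∷ y ∷ z ∷ []) W.size1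
    ... | w , w∈ , ≢x ∷ ≢y ∷ ≢z ∷ [] = w , proj₁ (W.sideX w) w∈ , ≢x , ≢y , ≢z

    fresh₂ : ∀ x y z → ∃ λ w → proj₁ (L w) ≡ s2 × w ≢ x × w ≢ y × w ≢ z
    fresh₂ x y z with fresh (∁ X) (x ∷ y ∷ z ∷ []) W.size2
    ... | w , w∈ , ≢x ∷ ≢y ∷ ≢z ∷ [] with proj₁ (L w) in e
    ...   | s2 = w , e , ≢x , ≢y , ≢z
    ...   | s1 = ⊥-elim (x∈∁p⇒x∉p w∈ (proj₂ (W.sideX w) e))

  weak⇒pair : Empty4 L s1 wC → Empty4 L s1 wD → NonEmpty4 L s2 wC → NonEmpty4 L s2 wD →
    ∃ λ A → ∃ λ B → ProperHomogeneousPair T A B × (∀ v → (v ∈ X → v ∈ A ⊎ v ∈ B) × (v ∈ A ⊎ v ∈ B → v ∈ X))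
  weak⇒pair noC noD (c , Lc) (d , Ld) = _ , _ , pair⇒proper G pair , λ v → to v , from v
    where
    place : Side × Role4 → Place
    place (s1 , wA) = inn hA
    place (s1 , wB) = inn hB
    -- Default values: C₁ and D₁ are empty here.
    place (s1 , wC) = inn hA
    place (s1 , wD) = inn hA
    place (s2 , r)  = out r

    f : Fin n → Place
    f = place ∘ L

    unA : ∀ {v} → f v ≡ inn hA → L v ≡ (s1 , wA)
    unA {v} e with L v in e′
    ... | s1 , wA = refl
    ... | s1 , wC = ⊥-elim (noC v e′)
    ... | s1 , wD = ⊥-elim (noD v e′)
    unA {v} () | s1 , wB
    unA {v} () | s2 , _
    unB : ∀ {v} → f v ≡ inn hB → L v ≡ (s1 , wB)
    unB {v} e with L v
    ... | s1 , wB = refl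
    unB {v} () | s1 , wA
    unB {v} () | s1 , wC
    unB {v} () | s1 , wD
    unB {v} () | s2 , _
    unO : ∀ {v o} → f v ≡ out o → L v ≡ (s2 , o)
    unO {v} e with L v
    unO {v} refl | s2 , _ = refl
    unO {v} () | s1 , wA
    unO {v} () | s1 , wB
    unO {v} () | s1 , wC
    unO {v} () | s1 , wD

    rel : ∀ {u v} r o → f u ≡ inn r → f v ≡ out o → θ T u v ≡ pairSign r o
    rel hA wA eu ev = W.A-comp _ _ (unA eu) (inj₁ (unO ev))
    rel hA wB eu ev = W.A-anti _ _ (unA eu) (inj₁ (unO ev))
    rel hA wC eu ev = W.A-anti _ _ (unA eu) (inj₂ (unO ev))
    rel hA wD eu ev = W.A-comp _ _ (unA eu) (inj₂ (unO ev))
    rel hB wA eu ev = W.B-anti _ _ (unB eu) (inj₁ (unO ev))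
    rel hB wB eu ev = W.B-comp _ _ (unB eu) (inj₁ (unO ev))
    rel hB wC eu ev = W.B-anti _ _ (unB eu) (inj₂ (unO ev))
    rel hB wD eu ev = W.B-comp _ _ (unB eu) (inj₂ (unO ev))

    inner : ∀ {p} → proj₁ p ≡ s1 → ∃ λ r → place p ≡ inn r
    inner {.s1 , wA} refl = hA , refl
    inner {.s1 , wB} refl = hB , refl
    inner {.s1 , wC} refl = hA , refl
    inner {.s1 , wD} refl = hA , refl

    nonempty : ∀ p → ∃ λ v → f v ≡ p
    nonempty (inn hA) = map₂ (cong place) (W.nonemptyA s1)
    nonempty (inn hB) = map₂ (cong place) (W.nonemptyB s1)
    nonempty (out wA) = map₂ (cong place) (W.nonemptyA s2)
    nonempty (out wB) = map₂ (cong place) (W.nonemptyB s2)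
    nonempty (out wC) = c , cong place Lc
    nonempty (out wD) = d , cong place Ld

    pair : IsPair T f
    pair = record
      { rel = rel _ _
      ; nonempty = nonempty
      ; big = λ x y z → let w , e , ≢s = fresh₁ x y z in w , inner e , ≢s }

    is? : ∀ p v → Dec (f v ≡ p)
    is? p v = f v ≟Pl p

    to : ∀ v → v ∈ X → v ∈ select (is? (inn hA)) ⊎ v ∈ select (is? (inn hB))
    to v v∈ with inner (proj₁ (W.sideX v) v∈)
    ... | hA , e = inj₁ (∈-select⁺ (is? (inn hA)) e)
    ... | hB , e = inj₂ (∈-select⁺ (is? (inn hB)) e)

    from : ∀ v → v ∈ select (is? (inn hA)) ⊎ v ∈ select (is? (inn hB)) → v ∈ X
    from v (inj₁ v∈) = proj₂ (W.sideX v) (cong proj₁ (unA (∈-select⁻ (is? (inn hA)) v∈)))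
    from v (inj₂ v∈) = proj₂ (W.sideX v) (cong proj₁ (unB (∈-select⁻ (is? (inn hB)) v∈)))

  weak⇒2join : Empty4 L s1 wD → Empty4 L s2 wD → IsProper2Join T X
  weak⇒2join noD₁ noD₂ = M , 2join , λ s Y C Y⇔ isC →
    meets s (λ v∈ → proj₁ (Y⇔ _) (proj₁ isC v∈)) (proj₁ (proj₂ isC))
      (λ u v u∈ e → Components.component-closed (Adj T) (adj-sym T) isC u v u∈ (proj₂ (Y⇔ v) e))
    where
    role : Role4 → Role3
    role wA = rA
    role wB = rB
    role wC = rC
    -- A default value, as D₁ and D₂ are empty.
    role wD = rC

    M : Fin n → Side × Role3
    M v = proj₁ (L v) , role (proj₂ (L v))

    noD : ∀ s v → L v ≢ (s , wD)
    noD s1 = noD₁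
    noD s2 = noD₂

    unA : ∀ {v s} → M v ≡ (s , rA) → L v ≡ (s , wA)
    unA {v} e with L v
    unA {v} refl | _ , wA = refl
    unA {v} () | _ , wB
    unA {v} () | _ , wC
    unA {v} () | _ , wD
    unB : ∀ {v s} → M v ≡ (s , rB) → L v ≡ (s , wB)
    unB {v} e with L v
    unB {v} refl | _ , wB = refl
    unB {v} () | _ , wA
    unB {v} () | _ , wC
    unB {v} () | _ , wD
    unC : ∀ {v s} → M v ≡ (s , rC) → L v ≡ (s , wC)
    unC {v} e with L v in e′
    unC {v} refl | _ , wC = refl
    unC {v} refl | _ , wD = ⊥-elim (noD _ v e′)
    unC {v} () | _ , wA
    unC {v} () | _ , wB

    rel : ∀ {u v} r r′ → M u ≡ (s1 , r) → M v ≡ (s2 , r′) → θ T u v ≡ joinSign r r′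
    rel rA rA eu ev = W.A-comp _ _ (unA eu) (inj₁ (unA ev))
    rel rA rB eu ev = W.A-anti _ _ (unA eu) (inj₁ (unB ev))
    rel rA rC eu ev = W.A-anti _ _ (unA eu) (inj₂ (unC ev))
    rel rB rA eu ev = W.B-anti _ _ (unB eu) (inj₁ (unA ev))
    rel rB rB eu ev = W.B-comp _ _ (unB eu) (inj₁ (unB ev))
    rel rB rC eu ev = W.B-anti _ _ (unB eu) (inj₂ (unC ev))
    rel rC rA eu ev = W.C-anti _ _ (unC eu) (inj₁ (unA ev))
    rel rC rB eu ev = W.C-anti _ _ (unC eu) (inj₂ (inj₁ (unB ev)))
    rel rC rC eu ev = W.C-anti _ _ (unC eu) (inj₂ (inj₂ (unC ev)))

    image : ∀ {s r} → NonEmpty4 L s r → ∃ λ v → M v ≡ (s , role r)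
    image = map₂ (cong (λ p → proj₁ p , role (proj₂ p)))

    J : IsJoin T M
    J = record { rel = rel _ _ ; nonemptyA = image ∘ W.nonemptyA ; nonemptyB = image ∘ W.nonemptyB }

    freshₛ : ∀ s x y z → ∃ λ w → proj₁ (L w) ≡ s × w ≢ x × w ≢ y × w ≢ z
    freshₛ s1 = fresh₁
    freshₛ s2 = fresh₂

    anti : ∀ u v r r′ → M u ≡ (s1 , r) → M v ≡ (s2 , r′) → ¬ (r ≡ rA × r′ ≡ rA) → ¬ (r ≡ rB × r′ ≡ rB) → StrAnti T u v
    anti u v rA rA eu ev h _ = ⊥-elim (h (refl , refl))
    anti u v rA rB eu ev _ _ = rel rA rB eu ev
    anti u v rA rC eu ev _ _ = rel rA rC eu ev
    anti u v rB rA eu ev _ _ = rel rB rA eu ev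
    anti u v rB rB eu ev _ h = ⊥-elim (h (refl , refl))
    anti u v rB rC eu ev _ _ = rel rB rC eu ev
    anti u v rC r  eu ev _ _ = rel rC r eu ev

    2join : Is2Join T X M
    2join = record
      { sideX = W.sideX
      ; nonemptyA = IsJoin.nonemptyA J
      ; nonemptyB = IsJoin.nonemptyB J
      ; compAA = λ u v → rel rA rA
      ; compBB = λ u v → rel rB rB
      ; anti = anti
      ; size1 = ℕₚ.<⇒≤ W.size1
      ; size2 = ℕₚ.<⇒≤ W.size2
      -- With at least four vertices, the side is never {a, b, m}.
      ; notP2 = λ s a b m _ _ _ _ _ _ _ only _ _ _ →
          let w , e , w≢a , w≢b , w≢m = freshₛ s a b m in
          [ w≢a , [ w≢b , w≢m ]′ ]′ (only w e)
      }

    -- Flipping sides and swapping A with B reduce all four claims to `closed-meets-A`.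
    meets : ∀ s {C : Subset n} → (∀ {v} → v ∈ C → proj₁ (L v) ≡ s) → (∃ λ v → v ∈ C) →
      (∀ u v → u ∈ C → proj₁ (L v) ≡ s → Adj T u v → v ∈ C) →
      (∃ λ v → v ∈ C × M v ≡ (s , rA)) × (∃ λ v → v ∈ C × M v ≡ (s , rB))
    meets s1 C⊆ ne closed =
        closed-meets-A G J big C⊆ ne closed
      , map₂ (map₂ unswap) (closed-meets-A G (join-swap J) big C⊆ ne closed)
      where
      big : ∀ x y → ∃ λ w → proj₁ (L w) ≡ s1 × w ≢ x × w ≢ y
      big x y = let w , e , w≢x , w≢y , _ = fresh₁ x y y in w , e , w≢x , w≢y
    meets s2 C⊆ ne closed =
        map₂ (map₂ unflip) (closed-meets-A G (join-flip J) big (cong other ∘ C⊆) ne closed′)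
      , map₂ (map₂ (unflip ∘ unswap)) (closed-meets-A G (join-swap (join-flip J)) big (cong other ∘ C⊆) ne closed′)
      where
      big : ∀ x y → ∃ λ w → other (proj₁ (L w)) ≡ s1 × w ≢ x × w ≢ y
      big x y = let w , e , w≢x , w≢y , _ = fresh₂ x y y in w , cong other e , w≢x , w≢y
      closed′ : ∀ u v → u ∈ _ → other (proj₁ (L v)) ≡ s1 → Adj T u v → v ∈ _
      closed′ u v u∈ e = closed u v u∈ (trans (sym (other-involutive (proj₁ (L v)))) (cong other e))

theorem10p1 : ∀ {n : ℕ} (T : Trigraph n) → InF T → ¬ HasBalancedSkewPartition T →
    (X : Subset n) → (WeakFragment T X → ProperFragment T X) × (ProperFragment T X → WeakFragment T X)
theorem10p1 {n} T inF no-balanced X = to , from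
  where
  G : Tame T
  G = InF⇒Tame inF no-balanced

  to : WeakFragment T X → ProperFragment T X
  to (L , W) with IsWeakFragmentBy.cases W
  ... | inj₁ (noC , noD , c , d)    = inj₂ (inj₂ (weak⇒pair G W noC noD c d))
  ... | inj₂ (inj₁ (noD₁ , noD₂))   = inj₁ (weak⇒2join G W noD₁ noD₂)
  ... | inj₂ (inj₂ (noC₁ , noC₂))   = inj₂ (inj₁ (weak⇒2join (tame-compl G) (weak-compl (λ _ _ → refl) W)
    (λ v e → noC₁ v (back v e)) (λ v e → noC₂ v (back v e))))
    where
    back : ∀ v {q} → complL (L v) ≡ q → L v ≡ complL q
    back v e = trans (sym (complL-involutive (L v))) (cong complL e)

  from : ProperFragment T X → WeakFragment T X
  from (inj₁ join)                    = proper2join⇒weak G join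
  from (inj₂ (inj₁ join))             = let L , W = proper2join⇒weak (tame-compl G) join in
    complL ∘ L , weak-compl (λ u v → sym (negT-involutive (θ T u v))) W
  from (inj₂ (inj₂ (_ , _ , H , X⇔))) = pair⇒weak H X⇔
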